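{- Let $\mathbf{G}$ be the set of rooted non-separable triangulations in which every vertex not incident to the root has degree at least $3$, and let $\mathbf{G}^*$ be the set of rooted non-separable triangulations in which every vertex has degree at least $3$. Let $G(t)$ and $G^*(t)$ be the generating functions of $\mathbf{G}$ and $\mathbf{G}^*$ respectively, where a map with $3n$ edges contributes $t^n$. Then $$G^*(t)=(1-2t)\,G(t).$$
   Context: A (planar) map is a proper embedding of a connected graph (loops and multiple edges a priori allowed) into the two-dimensional sphere, considered up to continuous (orientation-preserving) deformations. A map is rooted if one of its edges is distinguished as the root and given an orientation. A map is a triangulation if all its faces have degree $3$. A map is non-separable if it is loopless and 2-connected (the deletion of any vertex does not disconnect the map); multiple edges are allowed. A vertex is incident to the root if it is one of the two endpoints of the root edge. The number of edges of a triangulation is always a multiple of $3$; a triangulation with $3n$ edges has $2n$ faces and $n+2$ vertices. The series $G(t)$ is the unique power series in $t$ satisfying $16t^{2}G^{3}+8t(t^{2}+8t+1)G^{2}+(t^{4}+20t^{3}+50t^{2}-16t+1)G+t^{2}(t^2+11t-1)=0$. -}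

module Defs where

open import Level using (0ℓ)
open import Data.Nat.Base as ℕ using (ℕ; zero; suc; _∸_)
import Data.Nat.Properties as ℕ
open import Data.Integer.Base as ℤ using (ℤ; +_; -_)
import Data.Integer.Properties as ℤ
open import Data.Fin.Base using (Fin; zero; suc; toℕ; punchIn)
open import Data.Fin.Properties using (_≟_; all?)
open import Data.Fin.Permutation as Perm
  using (Permutation′; _⟨$⟩ʳ_; _⟨$⟩ˡ_; _∘ₚ_; insert; remove; ↔⇒≡)
open import Data.List.Base as List
  using (List; []; _∷_; length; filter; deduplicate; allFin; concatMap; cartesianProductWith)
open import Data.List.Properties using (filter-≐)
open import Data.List.Relation.Unary.Any as Any using (Any; here; there)
import Data.List.Relation.Unary.Any.Properties as Any
import Data.List.Relation.Unary.All as All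
open import Data.List.Relation.Unary.AllPairs using ([]; _∷_)
import Data.List.Relation.Unary.Unique.Setoid as Unique
import Data.List.Relation.Unary.Unique.DecSetoid.Properties as Unique
import Data.List.Membership.Setoid as MembershipBase
import Data.List.Membership.Setoid.Properties as Membership
open import Data.List.Membership.Propositional using (_∈_)
open import Data.List.Membership.Propositional.Properties using (∈-allFin; ∈-lookup)
open import Data.List.Relation.Unary.Enumerates.Setoid using (IsEnumeration)
open import Data.Product.Base using (Σ; ∃; _×_; _,_; proj₁; proj₂)
open import Data.Sum.Base as Sum using (_⊎_; inj₁; inj₂)
open import Algebra.Definitions.RawMonoid ℤ.+-0-rawMonoid using (sum)
open import Function.Base using (_∘_; _on_)
open import Function.Bundles using (Inverse)
import Function.Construct.Composition as Composition
import Function.Construct.Symmetry as Symmetry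
open import Relation.Nullary using (¬_; Dec; yes; no; contradiction)
open import Relation.Nullary.Decidable using (map′; _×-dec_; _⊎-dec_; _→-dec_; ¬?)
open import Relation.Unary using (Pred)
import Relation.Unary as Unary
open import Relation.Binary.Core using (Rel; _⇒_)
open import Relation.Binary.Bundles using (Setoid; DecSetoid)
open import Relation.Binary.Structures using (IsEquivalence)
open import Relation.Binary.Definitions using (Decidable)
import Relation.Binary.Construct.On as On
open import Relation.Binary.Construct.Closure.ReflexiveTransitive using (Star; ε; _◅_; _◅◅_)
open import Relation.Binary.Construct.Closure.Symmetric using (SymClosure; fwd; bwd)
open import Relation.Binary.Construct.Closure.Equivalence as EqC using (EqClosure)
open import Relation.Binary.PropositionalEquality
  using (_≡_; _≢_; refl; sym; trans; cong; cong₂; subst; module ≡-Reasoning)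
import Relation.Binary.PropositionalEquality as ≡

record FiniteSetoid : Set₁ where
  field
    decSetoid : DecSetoid 0ℓ 0ℓ
  open DecSetoid decSetoid public using (Carrier; _≈_; setoid)
  field
    elements : List Carrier
    complete : IsEnumeration setoid elements

module _ (F : FiniteSetoid) where
  open FiniteSetoid F
  private module D = DecSetoid decSetoid

  representatives : List Carrier
  representatives = deduplicate D._≟_ elements

  -- The number of equivalence classes, by ∣∣-inverse.
  ∣_∣ : ℕ
  ∣_∣ = length representatives

  private
    module M = MembershipBase setoid

    rep∈ : ∀ x → x M.∈ representatives
    rep∈ x = Membership.∈-deduplicate⁺ setoid D._≟_
      (λ z≈y x≈y → D.trans x≈y (D.sym z≈y)) (complete x)

    lookup-injective : ∀ {xs} → Unique.Unique setoid xs →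
                       ∀ i j → List.lookup xs i D.≈ List.lookup xs j → i ≡ j
    lookup-injective (_ ∷ _)  zero    zero    _  = refl
    lookup-injective (p ∷ _)  zero    (suc j) eq = contradiction eq (All.lookup p (∈-lookup j))
    lookup-injective (p ∷ _)  (suc i) zero    eq = contradiction (D.sym eq) (All.lookup p (∈-lookup i))
    lookup-injective (_ ∷ us) (suc i) (suc j) eq = cong suc (lookup-injective us i j eq)

  ∣∣-inverse : Inverse setoid (≡.setoid (Fin ∣_∣))
  ∣∣-inverse = record
    { to        = to
    ; from      = from
    ; to-cong   = to-cong
    ; from-cong = λ { refl → D.refl }
    ; inverse   = (λ {i} {x} eq → lookup-injective unique _ _ (D.trans (from-to x) eq))
                , (λ {x} {i} eq → D.trans (D.reflexive (cong from eq)) (from-to x))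
    }
    where
    unique = Unique.deduplicate-! decSetoid elements
    to : Carrier → Fin ∣_∣
    to x = Any.index (rep∈ x)
    from : Fin ∣_∣ → Carrier
    from = List.lookup representatives
    from-to : ∀ x → from (to x) D.≈ x
    from-to x = D.sym (Any.lookup-index (rep∈ x))
    to-cong : ∀ {x y} → x D.≈ y → to x ≡ to y
    to-cong {x} {y} x≈y = lookup-injective unique _ _
      (D.trans (from-to x) (D.trans x≈y (D.sym (from-to y))))

∣∣-cong : ∀ E F → Inverse (FiniteSetoid.setoid E) (FiniteSetoid.setoid F) → ∣ E ∣ ≡ ∣ F ∣
∣∣-cong E F E↔F = ↔⇒≡
  (Composition.inverse (Symmetry.inverse (∣∣-inverse E)) (Composition.inverse E↔F (∣∣-inverse F)))

module _ {m} {R : Rel (Fin m) 0ℓ} (R? : Decidable R) where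

  private
    -- Warshall: paths whose intermediate points lie in zs.
    Via : List (Fin m) → Rel (Fin m) 0ℓ
    Via []       x y = x ≡ y ⊎ R x y
    Via (z ∷ zs) x y = Via zs x y ⊎ (Via zs x z × Via zs z y)

    via? : ∀ zs → Decidable (Via zs)
    via? []       x y = (x ≟ y) ⊎-dec R? x y
    via? (z ∷ zs) x y = via? zs x y ⊎-dec (via? zs x z ×-dec via? zs z y)

    via⇒star : ∀ zs → Via zs ⇒ Star R
    via⇒star []       (inj₁ refl)    = ε
    via⇒star []       (inj₂ r)       = r ◅ ε
    via⇒star (z ∷ zs) (inj₁ p)       = via⇒star zs p
    via⇒star (z ∷ zs) (inj₂ (p , q)) = via⇒star zs p ◅◅ via⇒star zs q

    base : ∀ zs → Via [] ⇒ Via zs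
    base []       p = p
    base (z ∷ zs) p = inj₁ (base zs p)

    via-trans : ∀ {zs x y z} → z ∈ zs → Via zs x z → Via zs z y → Via zs x y
    via-trans (here refl) p q = inj₂ (Sum.[ (λ p → p) , proj₁ ] p , Sum.[ (λ q → q) , proj₂ ] q)
    via-trans (there i) (inj₁ p)       (inj₁ q)       = inj₁ (via-trans i p q)
    via-trans (there i) (inj₁ p)       (inj₂ (q , r)) = inj₂ (via-trans i p q , r)
    via-trans (there i) (inj₂ (p , q)) (inj₁ r)       = inj₂ (p , via-trans i q r)
    via-trans (there i) (inj₂ (p , _)) (inj₂ (_ , r)) = inj₂ (p , r)

    star⇒via : Star R ⇒ Via (allFin m)
    star⇒via ε       = base (allFin m) (inj₁ refl)
    star⇒via (r ◅ p) = via-trans (∈-allFin _) (base (allFin m) (inj₂ r)) (star⇒via p)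

  star? : Decidable (Star R)
  star? x y = map′ (via⇒star (allFin m)) star⇒via (via? (allFin m) x y)

eqClosure? : ∀ {m} {R : Rel (Fin m) 0ℓ} → Decidable R → Decidable (EqClosure R)
eqClosure? R? = star? λ x y →
  map′ Sum.[ fwd , bwd ] (λ { (fwd r) → inj₁ r ; (bwd r) → inj₂ r }) (R? x y ⊎-dec R? y x)

module _ {m} (π : Permutation′ m) where

  SameOrbit : Rel (Fin m) 0ℓ
  SameOrbit = EqClosure (λ x y → π ⟨$⟩ʳ x ≡ y)

  sameOrbit? : Decidable SameOrbit
  sameOrbit? = eqClosure? (λ x y → π ⟨$⟩ʳ x ≟ y)

  orbitSize : Fin m → ℕ
  orbitSize x = length (filter (sameOrbit? x) (allFin m))

  orbits : FiniteSetoid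
  orbits = record
    { decSetoid = record
      { isDecEquivalence = record
        { isEquivalence = EqC.isEquivalence _
        ; _≟_           = sameOrbit?
        }
      }
    ; elements = allFin m
    ; complete = λ x → Any.map (λ { refl → ε }) (∈-allFin x)
    }

-- A map on an oriented surface, as a rotation system.  Each edge consists
-- of two darts (half-edges, or orientations of the edge); the darts are the
-- elements of Fin m.  σ sends a dart to the next one around its initial
-- vertex and α reverses a dart, so that vertices, edges and faces are the
-- orbits of σ, α and φ, and the degree of a vertex or face is the size of
-- its orbit.
record Rotation (m : ℕ) : Set where
  constructor rotation
  field
    σ α : Permutation′ m

  φ : Permutation′ m
  φ = α ∘ₚ σ

  SameVertex : Rel (Fin m) 0ℓ
  SameVertex = SameOrbit σ

  degree : Fin m → ℕ
  degree = orbitSize σ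

  faceDegree : Fin m → ℕ
  faceDegree = orbitSize φ

  Step : Rel (Fin m) 0ℓ
  Step x y = σ ⟨$⟩ʳ x ≡ y ⊎ α ⟨$⟩ʳ x ≡ y

  Connected : Set
  Connected = ∀ x y → EqClosure Step x y

  Loopless : Set
  Loopless = ∀ x → ¬ SameVertex x (α ⟨$⟩ʳ x)

  -- Darts x and y not at the vertex of v are related iff their initial
  -- vertices are connected after deleting the vertex of v: σ-steps stay at a
  -- vertex, and α-steps traverse an edge neither of whose ends is deleted.
  JoinedAvoiding : Fin m → Rel (Fin m) 0ℓ
  JoinedAvoiding v = EqClosure λ x y → ¬ SameVertex v x × ¬ SameVertex v y × Step x y

  TwoConnected : Set
  TwoConnected = ∀ v x y → ¬ SameVertex v x → ¬ SameVertex v y → JoinedAvoiding v x y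

  NonSeparable : Set
  NonSeparable = Loopless × TwoConnected

  Triangulation : Set
  Triangulation = ∀ x → faceDegree x ≡ 3

-- Since α is a fixed-point-free involution of 2e darts, there are e edges;
-- a connected map lies on the sphere iff V + F = E + 2.
record IsPlanarMap (e : ℕ) (R : Rotation (2 ℕ.* e)) : Set where
  constructor isPlanarMap
  open Rotation R
  field
    α-involutive : ∀ x → α ⟨$⟩ʳ (α ⟨$⟩ʳ x) ≡ x
    α-free       : ∀ x → α ⟨$⟩ʳ x ≢ x
    connected    : Connected
    euler        : ∣ orbits σ ∣ ℕ.+ ∣ orbits φ ∣ ≡ e ℕ.+ 2

record RootedMap (e : ℕ) : Set where
  constructor rootedMap
  field
    rot    : Rotation (2 ℕ.* e)
    planar : IsPlanarMap e rot
    root   : Fin (2 ℕ.* e)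
  open Rotation rot public
  open IsPlanarMap planar public

  IncidentToRoot : Fin (2 ℕ.* e) → Set
  IncidentToRoot x = SameVertex root x ⊎ SameVertex (α ⟨$⟩ʳ root) x

-- The deformation classes of rooted maps are the classes of ≅: commuting with
-- σ (rather than reversing it) makes π orientation-preserving.
record _≅_ {e} (M N : RootedMap e) : Set where
  constructor iso
  private
    module M = RootedMap M
    module N = RootedMap N
  field
    π      : Permutation′ (2 ℕ.* e)
    π-σ    : ∀ x → π ⟨$⟩ʳ (M.σ ⟨$⟩ʳ x) ≡ N.σ ⟨$⟩ʳ (π ⟨$⟩ʳ x)
    π-α    : ∀ x → π ⟨$⟩ʳ (M.α ⟨$⟩ʳ x) ≡ N.α ⟨$⟩ʳ (π ⟨$⟩ʳ x)
    π-root : π ⟨$⟩ʳ M.root ≡ N.root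

record 𝐆 {e} (M : RootedMap e) : Set where
  constructor mk𝐆
  open RootedMap M
  field
    triangulation : Triangulation
    nonSeparable  : NonSeparable
    degree≥3      : ∀ x → ¬ IncidentToRoot x → 3 ℕ.≤ degree x

record 𝐆* {e} (M : RootedMap e) : Set where
  constructor mk𝐆*
  open RootedMap M
  field
    triangulation : Triangulation
    nonSeparable  : NonSeparable
    degree≥3      : ∀ x → 3 ℕ.≤ degree x

module _ {m} (R : Rotation m) where
  open Rotation R

  private
    step? : Decidable Step
    step? x y = (σ ⟨$⟩ʳ x ≟ y) ⊎-dec (α ⟨$⟩ʳ x ≟ y)

  connected? : Dec Connected
  connected? = all? λ x → all? λ y → eqClosure? step? x y

  triangulation? : Dec Triangulation
  triangulation? = all? λ x → faceDegree x ℕ.≟ 3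

  nonSeparable? : Dec NonSeparable
  nonSeparable? =
    (all? λ x → ¬? (sameOrbit? σ x (α ⟨$⟩ʳ x))) ×-dec
    (all? λ v → all? λ x → all? λ y →
      ¬? (sameOrbit? σ v x) →-dec ¬? (sameOrbit? σ v y) →-dec
      eqClosure? (λ x y → ¬? (sameOrbit? σ v x) ×-dec ¬? (sameOrbit? σ v y) ×-dec step? x y) x y)

isPlanarMap? : ∀ e R → Dec (IsPlanarMap e R)
isPlanarMap? e R = map′ (λ (a , b , c , d) → isPlanarMap a b c d)
                        (λ (isPlanarMap a b c d) → a , b , c , d)
  ((all? λ x → α ⟨$⟩ʳ (α ⟨$⟩ʳ x) ≟ x) ×-dec
   (all? λ x → ¬? (α ⟨$⟩ʳ x ≟ x)) ×-dec
   connected? R ×-dec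
   (∣ orbits σ ∣ ℕ.+ ∣ orbits φ ∣ ℕ.≟ e ℕ.+ 2))
  where open Rotation R

𝐆? : ∀ {e} → Unary.Decidable (𝐆 {e})
𝐆? M = map′ (λ (a , b , c) → mk𝐆 a b c) (λ (mk𝐆 a b c) → a , b , c)
  (triangulation? rot ×-dec nonSeparable? rot ×-dec
   (all? λ x → ¬? (sameOrbit? σ root x ⊎-dec sameOrbit? σ (α ⟨$⟩ʳ root) x) →-dec 3 ℕ.≤? degree x))
  where open RootedMap M

𝐆*? : ∀ {e} → Unary.Decidable (𝐆* {e})
𝐆*? M = map′ (λ (a , b , c) → mk𝐆* a b c) (λ (mk𝐆* a b c) → a , b , c)
  (triangulation? rot ×-dec nonSeparable? rot ×-dec (all? λ x → 3 ℕ.≤? degree x))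
  where open RootedMap M

permutations : ∀ n → List (Permutation′ n)
permutations zero    = Perm.id ∷ []
permutations (suc n) = cartesianProductWith (insert zero) (allFin (suc n)) (permutations n)

permutations-complete : ∀ {n} (π : Permutation′ n) → Any (π Perm.≈_) (permutations n)
permutations-complete {zero}  π = here λ ()
permutations-complete {suc n} π =
  Any.cartesianProductWith⁺ (insert zero) combine (∈-allFin (π ⟨$⟩ʳ zero))
    (permutations-complete (remove zero π))
  where
  combine : ∀ {j ρ} → π ⟨$⟩ʳ zero ≡ j → remove zero π Perm.≈ ρ → π Perm.≈ insert zero j ρ
  combine {ρ = ρ} refl eq zero = refl
  combine {ρ = ρ} refl eq (suc k) = begin
    π ⟨$⟩ʳ suc k                                             ≡⟨ Perm.insert-remove zero π (suc k) ⟨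
    insert zero (π ⟨$⟩ʳ zero) (remove zero π) ⟨$⟩ʳ suc k     ≡⟨ Perm.insert-punchIn zero (π ⟨$⟩ʳ zero) (remove zero π) k ⟩
    _                                                        ≡⟨ cong (punchIn (π ⟨$⟩ʳ zero)) (eq k) ⟩
    _                                                        ≡⟨ Perm.insert-punchIn zero (π ⟨$⟩ʳ zero) ρ k ⟨
    insert zero (π ⟨$⟩ʳ zero) ρ ⟨$⟩ʳ suc k                   ∎
    where open ≡-Reasoning

_≅?_ : ∀ {e} → Decidable (_≅_ {e})
_≅?_ {e} M N = map′ to from (Any.any? Iso? (permutations (2 ℕ.* e)))
  where
  module M = RootedMap M
  module N = RootedMap N
  Iso : Permutation′ (2 ℕ.* e) → Set
  Iso π = (∀ x → π ⟨$⟩ʳ (M.σ ⟨$⟩ʳ x) ≡ N.σ ⟨$⟩ʳ (π ⟨$⟩ʳ x)) ×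
          (∀ x → π ⟨$⟩ʳ (M.α ⟨$⟩ʳ x) ≡ N.α ⟨$⟩ʳ (π ⟨$⟩ʳ x)) ×
          π ⟨$⟩ʳ M.root ≡ N.root
  Iso? : Unary.Decidable Iso
  Iso? π = (all? λ x → _ ≟ _) ×-dec (all? λ x → _ ≟ _) ×-dec (_ ≟ _)
  to : Any Iso (permutations (2 ℕ.* e)) → M ≅ N
  to p with π , a , b , c ← Any.satisfied p = iso π a b c
  from : M ≅ N → Any Iso (permutations (2 ℕ.* e))
  from (iso π a b c) = Any.map (λ {ρ} → resp {ρ}) (permutations-complete π)
    where
    resp : ∀ {ρ} → π Perm.≈ ρ → Iso ρ
    resp eq = (λ x → trans (sym (eq _)) (trans (a x) (cong (N.σ ⟨$⟩ʳ_) (eq x))))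
            , (λ x → trans (sym (eq _)) (trans (b x) (cong (N.α ⟨$⟩ʳ_) (eq x))))
            , trans (sym (eq _)) c

≅-isEquivalence : ∀ {e} → IsEquivalence (_≅_ {e})
≅-isEquivalence = record
  { refl  = iso Perm.id (λ _ → refl) (λ _ → refl) refl
  ; sym   = λ {M} {N} (iso π a b c) → iso (Perm.flip π)
      (inv π (RootedMap.σ M) (RootedMap.σ N) a)
      (inv π (RootedMap.α M) (RootedMap.α N) b)
      (trans (cong (π ⟨$⟩ˡ_) (sym c)) (Perm.inverseˡ π))
  ; trans = λ (iso π a b c) (iso ρ a′ b′ c′) → iso (π ∘ₚ ρ)
      (λ x → trans (cong (ρ ⟨$⟩ʳ_) (a x)) (a′ _))
      (λ x → trans (cong (ρ ⟨$⟩ʳ_) (b x)) (b′ _))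
      (trans (cong (ρ ⟨$⟩ʳ_) c) c′)
  }
  where
  inv : ∀ {m} (π τ τ′ : Permutation′ m) →
        (∀ x → π ⟨$⟩ʳ (τ ⟨$⟩ʳ x) ≡ τ′ ⟨$⟩ʳ (π ⟨$⟩ʳ x)) →
        ∀ x → π ⟨$⟩ˡ (τ′ ⟨$⟩ʳ x) ≡ τ ⟨$⟩ʳ (π ⟨$⟩ˡ x)
  inv π τ τ′ eq x = trans
    (cong (π ⟨$⟩ˡ_) (trans (cong (τ′ ⟨$⟩ʳ_) (sym (Perm.inverseʳ π))) (sym (eq _))))
    (Perm.inverseˡ π)

module _ {m} (π ρ : Permutation′ m) (π≈ρ : π Perm.≈ ρ) where

  sameOrbit-resp : SameOrbit π ⇒ SameOrbit ρ
  sameOrbit-resp = EqC.map (trans (sym (π≈ρ _)))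

module _ {m} (π ρ : Permutation′ m) (π≈ρ : π Perm.≈ ρ) where

  private
    ρ≈π : ρ Perm.≈ π
    ρ≈π = sym ∘ π≈ρ

  orbitSize-resp : ∀ x → orbitSize π x ≡ orbitSize ρ x
  orbitSize-resp x = cong length
    (filter-≐ (sameOrbit? π x) (sameOrbit? ρ x) (sameOrbit-resp π ρ π≈ρ , sameOrbit-resp ρ π ρ≈π) (allFin m))

  orbits-resp : ∣ orbits π ∣ ≡ ∣ orbits ρ ∣
  orbits-resp = ∣∣-cong (orbits π) (orbits ρ) record
    { to        = λ x → x
    ; from      = λ x → x
    ; to-cong   = sameOrbit-resp π ρ π≈ρ
    ; from-cong = sameOrbit-resp ρ π ρ≈π
    ; inverse   = sameOrbit-resp π ρ π≈ρ , sameOrbit-resp ρ π ρ≈π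
    }

record _≐_ {m} (R S : Rotation m) : Set where
  constructor _,_
  field
    σ≈ : Rotation.σ R Perm.≈ Rotation.σ S
    α≈ : Rotation.α R Perm.≈ Rotation.α S

module _ {m} {R S : Rotation m} (R≐S : R ≐ S) where
  private
    module R = Rotation R
    module S = Rotation S
  open _≐_ R≐S

  private
    vertex⇒ : R.SameVertex ⇒ S.SameVertex
    vertex⇒ = sameOrbit-resp R.σ S.σ σ≈

    vertex⇐ : S.SameVertex ⇒ R.SameVertex
    vertex⇐ = sameOrbit-resp S.σ R.σ (sym ∘ σ≈)

    step⇒ : R.Step ⇒ S.Step
    step⇒ = Sum.map (trans (sym (σ≈ _))) (trans (sym (α≈ _)))

    φ≈ : R.φ Perm.≈ S.φ
    φ≈ x = trans (σ≈ _) (cong (S.σ ⟨$⟩ʳ_) (α≈ x))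

  triangulation-resp : R.Triangulation → S.Triangulation
  triangulation-resp t x = trans (sym (orbitSize-resp R.φ S.φ φ≈ x)) (t x)

  nonSeparable-resp : R.NonSeparable → S.NonSeparable
  nonSeparable-resp (loopless , two) =
    (λ x p → loopless x (vertex⇐ (subst (S.SameVertex x) (sym (α≈ x)) p))) ,
    (λ v x y p q → EqC.map (λ (a , b , s) → a ∘ vertex⇐ , b ∘ vertex⇐ , step⇒ s)
                     (two v x y (p ∘ vertex⇒) (q ∘ vertex⇒)))

  degree-resp : ∀ {k} x → k ℕ.≤ R.degree x → k ℕ.≤ S.degree x
  degree-resp x = subst (_ ℕ.≤_) (orbitSize-resp R.σ S.σ σ≈ x)

  connected-resp : R.Connected → S.Connected
  connected-resp c x y = EqC.map step⇒ (c x y)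

  euler-resp : ∀ {k} → ∣ orbits R.σ ∣ ℕ.+ ∣ orbits R.φ ∣ ≡ k →
               ∣ orbits S.σ ∣ ℕ.+ ∣ orbits S.φ ∣ ≡ k
  euler-resp = trans (sym (cong₂ ℕ._+_ (orbits-resp R.σ S.σ σ≈) (orbits-resp R.φ S.φ φ≈)))

isPlanarMap-resp : ∀ {e R S} → R ≐ S → IsPlanarMap e R → IsPlanarMap e S
isPlanarMap-resp {S = S} R≐S@(σ≈ , α≈) (isPlanarMap inv free conn eul) = isPlanarMap
  (λ x → trans (sym (trans (α≈ _) (cong (Rotation.α S ⟨$⟩ʳ_) (α≈ x)))) (inv x))
  (λ x eq → free x (trans (α≈ x) eq))
  (connected-resp R≐S conn)
  (euler-resp R≐S eul)

record _≋_ {e} (M N : RootedMap e) : Set where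
  constructor _,_
  private
    module M = RootedMap M
    module N = RootedMap N
  field
    rot≐  : M.rot ≐ N.rot
    root≡ : M.root ≡ N.root

≋⇒≅ : ∀ {e} → _≋_ {e} ⇒ _≅_
≋⇒≅ ((σ≈ , α≈) , root≡) = iso Perm.id σ≈ α≈ root≡

𝐆-resp : ∀ {e} {M N : RootedMap e} → M ≋ N → 𝐆 M → 𝐆 N
𝐆-resp {M = M} {N} (R≐S@(σ≈ , α≈) , refl) (mk𝐆 tri ns deg) = mk𝐆
  (triangulation-resp R≐S tri)
  (nonSeparable-resp R≐S ns)
  (λ x ¬inc → degree-resp R≐S x (deg x (¬inc ∘ Sum.map (sameOrbit-resp M.σ N.σ σ≈)
    (λ p → subst (λ r → N.SameVertex r x) (α≈ N.root) (sameOrbit-resp M.σ N.σ σ≈ p)))))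
  where
  module M = RootedMap M
  module N = RootedMap N

𝐆*-resp : ∀ {e} {M N : RootedMap e} → M ≋ N → 𝐆* M → 𝐆* N
𝐆*-resp (R≐S , refl) (mk𝐆* tri ns deg) = mk𝐆*
  (triangulation-resp R≐S tri)
  (nonSeparable-resp R≐S ns)
  (λ x → degree-resp R≐S x (deg x))

rootings : ∀ {e} → Rotation (2 ℕ.* e) → List (RootedMap e)
rootings {e} R with isPlanarMap? e R
... | yes p = List.map (rootedMap R p) (allFin (2 ℕ.* e))
... | no  _ = []

rotations : ∀ m → List (Rotation m)
rotations m = cartesianProductWith rotation (permutations m) (permutations m)

rootedMaps : ∀ e → List (RootedMap e)
rootedMaps e = concatMap rootings (rotations (2 ℕ.* e))

rootedMaps-complete : ∀ {e} (M : RootedMap e) → Any (M ≋_) (rootedMaps e)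
rootedMaps-complete {e} (rootedMap (rotation σ α) p r) =
  Any.concatMap⁺ rootings (Any.map inRootings
    (Any.cartesianProductWith⁺ rotation _,_ (permutations-complete σ) (permutations-complete α)))
  where
  inRootings : ∀ {S} → rotation σ α ≐ S → Any (rootedMap (rotation σ α) p r ≋_) (rootings S)
  inRootings {S} R≐S with isPlanarMap? e S
  ... | yes _ = Any.map⁺ (Any.map (R≐S ,_) (∈-allFin r))
  ... | no ¬q = contradiction (isPlanarMap-resp R≐S p) ¬q

module MapClass (e : ℕ) {P : Pred (RootedMap e) 0ℓ} (P? : Unary.Decidable P)
                (P-resp : ∀ {M N} → M ≋ N → P M → P N) where

  private
    keep : RootedMap e → List (∃ P)
    keep M with P? M
    ... | yes p = (M , p) ∷ []
    ... | no  _ = []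

  finiteSetoid : FiniteSetoid
  finiteSetoid = record
    { decSetoid = record
      { Carrier          = ∃ P
      ; _≈_              = _≅_ on proj₁
      ; isDecEquivalence = record
        { isEquivalence = On.isEquivalence proj₁ ≅-isEquivalence
        ; _≟_           = λ M N → proj₁ M ≅? proj₁ N
        }
      }
    ; elements = concatMap keep (rootedMaps e)
    ; complete = λ (M , p) → Any.concatMap⁺ keep (Any.map (kept M p) (rootedMaps-complete M))
    }
    where
    kept : ∀ M → P M → ∀ {N} → M ≋ N → Any (λ N′ → M ≅ proj₁ N′) (keep N)
    kept M p {N} M≋N with P? N
    ... | yes _ = here (≋⇒≅ M≋N)
    ... | no ¬q = contradiction (P-resp M≋N p) ¬q

𝐆-maps 𝐆*-maps : ℕ → FiniteSetoid
𝐆-maps  e = MapClass.finiteSetoid e 𝐆?  𝐆-resp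
𝐆*-maps e = MapClass.finiteSetoid e 𝐆*? 𝐆*-resp

Series : Set
Series = ℕ → ℤ

_⊛_ : Series → Series → Series
(A ⊛ B) n = sum {suc n} λ i → A (toℕ i) ℤ.* B (n ∸ toℕ i)

1−2t : Series
1−2t zero          = + 1
1−2t (suc zero)    = - (+ 2)
1−2t (suc (suc _)) = + 0

-- Isomorphism classes are counted.  A triangulation has 3n edges for some n,
-- and contributes to the coefficient of t^n.
G G* : Series
G  n = + ∣ 𝐆-maps  (3 ℕ.* n) ∣
G* n = + ∣ 𝐆*-maps (3 ℕ.* n) ∣

{-# OPTIONS --safe #-}

-- Suppose that an end v of the root edge of a map of 𝐆 has degree 2, with
-- neighbours a and b, where va is the root edge.  Both faces at v are triangles
-- vab, so v lies inside a 2-cycle formed by two edges ab; these edges are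
-- distinct, for otherwise b would have degree 2 without being incident to the
-- root.  Deleting v and merging the two edges gives a map of 𝐆 with three edges
-- fewer, rooted at the merged edge, and doubling the root edge and inserting a
-- vertex into the resulting 2-cycle is the inverse operation.  Since a then has
-- degree at least 3, v is either the origin or the end of the root but not
-- both, whence G (1 + n) = G* (1 + n) + 2 G n.

module Submission where

open import Defs
open import Level using (0ℓ)
open import Data.Nat.Base as ℕ using (ℕ; zero; suc)
import Data.Nat.Properties as ℕ
open import Data.Fin.Base using (Fin; zero; suc; punchIn; punchOut; _↑ˡ_; _↑ʳ_; splitAt; toℕ)
open import Data.Fin.Properties
  using (_≟_; injective⇒≤; +↔⊎; suc-injective; punchOut-injective; punchIn-punchOut;
         splitAt⁻¹-↑ˡ; splitAt⁻¹-↑ʳ)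
open import Data.Fin.Permutation as Perm
  using (Permutation; Permutation′; _⟨$⟩ʳ_; _⟨$⟩ˡ_; _∘ₚ_; inverseˡ; inverseʳ; ↔⇒≡;
         permutation; insert; remove; lift₀-remove; insert-punchIn; lift₀)
open import Data.List.Base using (List; []; _∷_; length; lookup; filter; allFin)
open import Data.List.Relation.Unary.Any as Any using (here; there)
open import Data.List.Relation.Unary.All as All using ([]; _∷_)
open import Data.List.Relation.Unary.AllPairs as AllPairs using ([]; _∷_)
open import Data.List.Relation.Unary.Any.Properties using (lookup-index)
open import Data.List.Relation.Unary.Unique.Propositional using (Unique)
open import Data.List.Relation.Unary.Unique.Propositional.Properties using (filter⁺; allFin⁺)
open import Data.List.Membership.Propositional using (_∈_)
open import Data.List.Membership.Propositional.Properties
  using (∈-lookup; ∈-filter⁺; ∈-filter⁻; ∈-allFin)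
open import Data.Product.Base using (_×_; _,_; proj₁; proj₂; ∃)
open import Function.Base using (_∘_; id)
open import Function.Bundles using (Injection; Inverse; Bijection)
open import Function.Properties.Inverse using (↔⇒↣)
open import Relation.Nullary using (¬_; yes; no; contradiction; Dec)
open import Relation.Binary.Construct.Closure.ReflexiveTransitive using (ε; _◅_; _◅◅_)
open import Relation.Binary.Construct.Closure.Symmetric using (fwd; bwd)
open import Relation.Binary.Construct.Closure.Equivalence as EqC using (EqClosure)
open import Data.Sum.Base as Sum using (_⊎_; inj₁; inj₂)
open import Data.Sum.Function.Setoid using (_⊎-inverse_)
open import Data.Sum.Relation.Binary.Pointwise using (_⊎ₛ_; Pointwise-≡↔≡; Pointwise; inj₁; inj₂)
import Function.Construct.Composition as Composition
import Function.Construct.Symmetry as Symmetry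
open import Relation.Binary.Core using (Rel)
open import Relation.Binary.Bundles using (Setoid)
import Data.Nat.Solver as ℕ
open import Data.Unit.Base using (⊤; tt)
open import Data.Integer.Base as ℤ using (ℤ; +_)
import Data.Integer.Properties as ℤ
import Data.Integer.Solver as ℤ
open import Function.Properties.Bijection using (Bijection⇒Inverse)
open import Relation.Binary.Structures using (IsEquivalence)
open import Algebra.Definitions.RawMonoid ℤ.+-0-rawMonoid using (sum)
open import Relation.Binary.PropositionalEquality hiding (J)
import Relation.Binary.PropositionalEquality as ≡

-- Deletion is never analysed on its own. A map with an end of degree 2 at the root is shown to be,
-- up to renaming darts, an insertion into some smaller rotation system, and every property is then
-- carried in both directions between a rotation system and its insertion. To make this work, each
-- permutation of the insertion is a fixed exchange of two pairs of darts composed with a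
-- permutation that acts on the six new darts and on the old ones separately. Bijectivity is then
-- immediate, and conversely undoing the exchange leaves a permutation that restricts to the old
-- darts, which produces the collapsed map. The two copies of the doubled edge keep one old dart
-- each. The picture then has a half-turn symmetry that swaps the two darts of the new vertex and
-- the two ends of the edge, so the cases come in mirrored pairs. The dart counts `6 + 2 * e` and
-- `2 * (3 + e)` are equal only propositionally; hence properties and isomorphisms are stated for
-- arbitrary numbers of darts.

private variable
  e m n k : ℕ

-- Orbits of a permutation and their sizes

perm-injective : (π : Permutation m n) → ∀ {x y} → π ⟨$⟩ʳ x ≡ π ⟨$⟩ʳ y → x ≡ y
perm-injective π = Injection.injective (↔⇒↣ π)

unique-lookup-injective : ∀ {A : Set} {xs : List A} → Unique xs →
                          ∀ i j → lookup xs i ≡ lookup xs j → i ≡ j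
unique-lookup-injective (_ ∷ _)  zero    zero    _  = refl
unique-lookup-injective (p ∷ _)  zero    (suc j) eq = contradiction eq (All.lookup p (∈-lookup j))
unique-lookup-injective (p ∷ _)  (suc i) zero    eq = contradiction (sym eq) (All.lookup p (∈-lookup i))
unique-lookup-injective (_ ∷ us) (suc i) (suc j) eq = cong suc (unique-lookup-injective us i j eq)

unique-⊆⇒length≤ : ∀ {A : Set} {xs ys : List A} → Unique xs →
                   (∀ {x} → x ∈ xs → x ∈ ys) → length xs ℕ.≤ length ys
unique-⊆⇒length≤ {xs = xs} {ys} u xs⊆ys = injective⇒≤ {f = λ i → Any.index (at i)} λ {i} {j} eq →
  unique-lookup-injective u i j
    (trans (lookup-index (at i)) (trans (cong (lookup ys) eq) (sym (lookup-index (at j)))))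
  where
  at : ∀ i → lookup xs i ∈ ys
  at i = xs⊆ys (∈-lookup {xs = xs} i)

module _ (π : Permutation′ m) where

  private
    infixl 9 π^_
    π^_ : Fin m → Fin m
    π^ x = π ⟨$⟩ʳ x

  sameOrbit-sym : ∀ {x y} → SameOrbit π x y → SameOrbit π y x
  sameOrbit-sym = EqC.symmetric _

  orbit-next : ∀ {x} → SameOrbit π x (π ⟨$⟩ʳ x)
  orbit-next = fwd refl ◅ ε

  orbit-closed : (P : Fin m → Set) → (∀ {y} → P y → P (π ⟨$⟩ʳ y)) → (∀ {y} → P (π ⟨$⟩ʳ y) → P y) →
                 ∀ {x y} → SameOrbit π x y → P x → P y
  orbit-closed P next prev ε              px = px
  orbit-closed P next prev (fwd refl ◅ c) px = orbit-closed P next prev c (next px)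
  orbit-closed P next prev (bwd refl ◅ c) px = orbit-closed P next prev c (prev px)

  private
    orbit : Fin m → List (Fin m)
    orbit x = filter (sameOrbit? π x) (allFin m)

    orbit-unique : ∀ x → Unique (orbit x)
    orbit-unique x = filter⁺ (sameOrbit? π x) (allFin⁺ m)

    ∈-orbit⁺ : ∀ {x y} → SameOrbit π x y → y ∈ orbit x
    ∈-orbit⁺ {x} = ∈-filter⁺ (sameOrbit? π x) (∈-allFin _)

    ∈-orbit⁻ : ∀ {x y} → y ∈ orbit x → SameOrbit π x y
    ∈-orbit⁻ {x} y∈ = proj₂ (∈-filter⁻ (sameOrbit? π x) {xs = allFin m} y∈)

    orbitSize≥ : ∀ {x xs} → Unique xs → All.All (SameOrbit π x) xs → length xs ℕ.≤ orbitSize π x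
    orbitSize≥ u all = unique-⊆⇒length≤ u (∈-orbit⁺ ∘ All.lookup all)

    orbitSize≤ : ∀ {x xs} → (∀ {y} → SameOrbit π x y → y ∈ xs) → orbitSize π x ℕ.≤ length xs
    orbitSize≤ {x} f = unique-⊆⇒length≤ (orbit-unique x) (f ∘ ∈-orbit⁻)

    next² : ∀ {x} → SameOrbit π x (π^ π^ x)
    next² = orbit-next ◅◅ orbit-next

    not-fixed : ∀ {x} → π^ π^ x ≢ x → π^ x ≢ x
    not-fixed ne eq = ne (trans (cong π^_ eq) eq)

    inj : ∀ {x y} → π^ x ≡ π^ y → x ≡ y
    inj = perm-injective π

  -- This and the next three lemmas turn degrees into equations: an orbit has at most two elements
  -- iff the square of `π` fixes them, and exactly three iff the cube fixes them but `π` does not.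
  orbitSize≥3⁺ : ∀ x → π ⟨$⟩ʳ (π ⟨$⟩ʳ x) ≢ x → 3 ℕ.≤ orbitSize π x
  orbitSize≥3⁺ x ne = orbitSize≥
    {xs = x ∷ π^ x ∷ π^ π^ x ∷ []}
    (((not-fixed ne ∘ sym) ∷ (ne ∘ sym) ∷ []) ∷ ((not-fixed ne ∘ inj ∘ sym) ∷ []) ∷ [] ∷ [])
    (ε ∷ orbit-next ∷ next² ∷ [])

  orbitSize≥3⁻ : ∀ x → 3 ℕ.≤ orbitSize π x → π ⟨$⟩ʳ (π ⟨$⟩ʳ x) ≢ x
  orbitSize≥3⁻ x 3≤ eq = ℕ.<⇒≱ 3≤ (orbitSize≤ λ c → orbit-closed (_∈ x ∷ π^ x ∷ []) next prev c (here refl))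
    where
    next : ∀ {y} → y ∈ x ∷ π^ x ∷ [] → π^ y ∈ x ∷ π^ x ∷ []
    next (here refl)         = there (here refl)
    next (there (here refl)) = here eq
    prev : ∀ {y} → π^ y ∈ x ∷ π^ x ∷ [] → y ∈ x ∷ π^ x ∷ []
    prev (here e)         = there (here (inj (trans e (sym eq))))
    prev (there (here e)) = here (inj e)

  orbitSize≡3⁺ : ∀ x → π ⟨$⟩ʳ x ≢ x → π ⟨$⟩ʳ (π ⟨$⟩ʳ (π ⟨$⟩ʳ x)) ≡ x → orbitSize π x ≡ 3
  orbitSize≡3⁺ x ne eq = ℕ.≤-antisym
    (orbitSize≤ λ c → orbit-closed (_∈ x ∷ π^ x ∷ π^ π^ x ∷ []) next prev c (here refl))
    (orbitSize≥3⁺ x λ e → ne (trans (sym (cong π^_ e)) eq))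
    where
    next : ∀ {y} → y ∈ x ∷ π^ x ∷ π^ π^ x ∷ [] → π^ y ∈ x ∷ π^ x ∷ π^ π^ x ∷ []
    next (here refl)                 = there (here refl)
    next (there (here refl))         = there (there (here refl))
    next (there (there (here refl))) = here eq
    prev : ∀ {y} → π^ y ∈ x ∷ π^ x ∷ π^ π^ x ∷ [] → y ∈ x ∷ π^ x ∷ π^ π^ x ∷ []
    prev (here e)                 = there (there (here (inj (trans e (sym eq)))))
    prev (there (here e))         = here (inj e)
    prev (there (there (here e))) = there (here (inj e))

  orbitSize≡3⁻ : ∀ x → orbitSize π x ≡ 3 → π ⟨$⟩ʳ x ≢ x × π ⟨$⟩ʳ (π ⟨$⟩ʳ (π ⟨$⟩ʳ x)) ≡ x
  orbitSize≡3⁻ x size = not-fixed ne , closes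
    where
    ne : π^ π^ x ≢ x
    ne = orbitSize≥3⁻ x (ℕ.≤-reflexive (sym size))
    closes : π^ π^ π^ x ≡ x
    closes with π^ π^ π^ x ≟ x
    ... | yes eq = eq
    ... | no ne³ = contradiction (subst (4 ℕ.≤_) size four) ℕ.1+n≰n
      where
      four : 4 ℕ.≤ orbitSize π x
      four = orbitSize≥ {xs = x ∷ π^ x ∷ π^ π^ x ∷ π^ π^ π^ x ∷ []}
        (((not-fixed ne ∘ sym) ∷ (ne ∘ sym) ∷ (ne³ ∘ sym) ∷ []) ∷
         ((not-fixed ne ∘ inj ∘ sym) ∷ (ne ∘ inj ∘ sym) ∷ []) ∷
         ((not-fixed ne ∘ inj ∘ inj ∘ sym) ∷ []) ∷ [] ∷ [])
        (ε ∷ orbit-next ∷ next² ∷ (next² ◅◅ orbit-next) ∷ [])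

  digon-invariant : ∀ {x y} → SameOrbit π x y → π ⟨$⟩ʳ (π ⟨$⟩ʳ x) ≡ x → π ⟨$⟩ʳ (π ⟨$⟩ʳ y) ≡ y
  digon-invariant = orbit-closed (λ y → π^ π^ y ≡ y) (cong π^_) inj

-- Cardinalities through bijections of setoids

HasSize : Setoid 0ℓ 0ℓ → ℕ → Set
HasSize S n = Inverse S (≡.setoid (Fin n))

⊎-hasSize : ∀ {S T} → HasSize S m → HasSize T n → HasSize (S ⊎ₛ T) (m ℕ.+ n)
⊎-hasSize S↔ T↔ = Composition.inverse (S↔ ⊎-inverse T↔)
  (Composition.inverse (Pointwise-≡↔≡ _ _) (Symmetry.inverse +↔⊎))

hasSize⇒∣∣≡ : ∀ F {S} → Inverse S (FiniteSetoid.setoid F) → HasSize S n → ∣ F ∣ ≡ n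
hasSize⇒∣∣≡ F S↔F S↔n = ↔⇒≡
  (Composition.inverse (Symmetry.inverse (∣∣-inverse F)) (Composition.inverse (Symmetry.inverse S↔F) S↔n))

empty⇒∣∣≡0 : ∀ F → ¬ FiniteSetoid.Carrier F → ∣ F ∣ ≡ 0
empty⇒∣∣≡0 F empty with ∣ F ∣ | ∣∣-inverse F
... | zero  | _ = refl
... | suc _ | i = contradiction (Inverse.from i zero) empty

-- Opaque because unfolding ∣_∣ over Fin (6 + m) starts to enumerate the orbits.
opaque
  #orbits : Permutation′ m → ℕ
  #orbits π = ∣ orbits π ∣

  #orbits≡∣orbits∣ : (π : Permutation′ m) → #orbits π ≡ ∣ orbits π ∣
  #orbits≡∣orbits∣ π = refl

-- Connectedness, and membership in `𝐆` over any number of darts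

module _ {m} (R : Rotation m) where
  open Rotation R

  -- Taking for `A` the darts off a vertex `v` gives `JoinedAvoiding v`, and taking all darts gives
  -- connectedness, so one transfer of paths serves both.
  Joined : (Fin m → Set) → Rel (Fin m) 0ℓ
  Joined A = EqClosure λ x y → A x × A y × Step x y

  joined-sym : ∀ {A x y} → Joined A x y → Joined A y x
  joined-sym = EqC.symmetric _

  vertex-joined : ∀ {A} → (∀ {x y} → SameVertex x y → A x → A y) →
                  ∀ {x y} → A x → SameVertex x y → Joined A x y
  vertex-joined resp a ε = ε
  vertex-joined resp a (fwd refl ◅ c) =
    let b = resp (fwd refl ◅ ε) a in fwd (a , b , inj₁ refl) ◅ vertex-joined resp b c
  vertex-joined resp a (bwd refl ◅ c) =
    let b = resp (bwd refl ◅ ε) a in bwd (b , a , inj₁ refl) ◅ vertex-joined resp b c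

-- Membership in 𝐆 for e edges, over any number of darts and with the degree
-- conditions expressed by short orbits.
record Is𝐆 (e : ℕ) {m} (R : Rotation m) (r : Fin m) : Set where
  open Rotation R
  field
    α-involutive : ∀ x → α ⟨$⟩ʳ (α ⟨$⟩ʳ x) ≡ x
    α-free       : ∀ x → α ⟨$⟩ʳ x ≢ x
    connected    : Connected
    euler        : #orbits σ ℕ.+ #orbits φ ≡ e ℕ.+ 2
    φ-free       : ∀ x → φ ⟨$⟩ʳ x ≢ x
    φ-cubic      : ∀ x → φ ⟨$⟩ʳ (φ ⟨$⟩ʳ (φ ⟨$⟩ʳ x)) ≡ x
    loopless     : Loopless
    twoConnected : TwoConnected
    no-digon     : ∀ x → ¬ SameVertex r x → ¬ SameVertex (α ⟨$⟩ʳ r) x → σ ⟨$⟩ʳ (σ ⟨$⟩ʳ x) ≢ x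

is𝐆-reverse : ∀ {R : Rotation m} {r} → Is𝐆 e R r → Is𝐆 e R (Rotation.α R ⟨$⟩ʳ r)
is𝐆-reverse {R = R} {r} g = record
  { Is𝐆 g
  ; no-digon = λ x p q → no-digon x (subst (λ y → ¬ SameVertex y x) (α-involutive r) q) p
  }
  where open Is𝐆 g; open Rotation R

𝐆⇒is𝐆 : ∀ {M : RootedMap e} → 𝐆 M → Is𝐆 e (RootedMap.rot M) (RootedMap.root M)
𝐆⇒is𝐆 {M = M} (mk𝐆 tri (loopless , two) deg) = record
  { α-involutive = α-involutive
  ; α-free       = α-free
  ; connected    = connected
  ; euler        = trans (cong₂ ℕ._+_ (#orbits≡∣orbits∣ σ) (#orbits≡∣orbits∣ φ)) euler
  ; φ-free       = λ x → proj₁ (orbitSize≡3⁻ φ x (tri x))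
  ; φ-cubic      = λ x → proj₂ (orbitSize≡3⁻ φ x (tri x))
  ; loopless     = loopless
  ; twoConnected = two
  ; no-digon     = λ x p q → orbitSize≥3⁻ σ x (deg x Sum.[ p , q ])
  }
  where open RootedMap M

is𝐆⇒planar : ∀ {R : Rotation (2 ℕ.* e)} {r} → Is𝐆 e R r → IsPlanarMap e R
is𝐆⇒planar {R = R} g = isPlanarMap α-involutive α-free connected
  (trans (sym (cong₂ ℕ._+_ (#orbits≡∣orbits∣ σ) (#orbits≡∣orbits∣ φ))) euler)
  where open Is𝐆 g; open Rotation R using (σ; φ)

is𝐆⇒𝐆 : ∀ {R : Rotation (2 ℕ.* e)} {r} (g : Is𝐆 e R r) → 𝐆 (rootedMap R (is𝐆⇒planar g) r)
is𝐆⇒𝐆 {R = R} g = mk𝐆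
  (λ x → orbitSize≡3⁺ φ x (φ-free x) (φ-cubic x))
  (loopless , twoConnected)
  (λ x p → orbitSize≥3⁺ σ x (no-digon x (p ∘ inj₁) (p ∘ inj₂)))
  where open Is𝐆 g; open Rotation R using (σ; φ)

-- Isomorphisms of rotation systems

record _≃_ (R : Rotation m) (S : Rotation n) : Set where
  private
    module R = Rotation R
    module S = Rotation S
  field
    ι   : Permutation m n
    ι-σ : ∀ x → ι ⟨$⟩ʳ (R.σ ⟨$⟩ʳ x) ≡ S.σ ⟨$⟩ʳ (ι ⟨$⟩ʳ x)
    ι-α : ∀ x → ι ⟨$⟩ʳ (R.α ⟨$⟩ʳ x) ≡ S.α ⟨$⟩ʳ (ι ⟨$⟩ʳ x)

intertwine⁻¹ : (ι : Permutation m n) (π : Permutation′ m) (ρ : Permutation′ n) →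
               (∀ x → ι ⟨$⟩ʳ (π ⟨$⟩ʳ x) ≡ ρ ⟨$⟩ʳ (ι ⟨$⟩ʳ x)) →
               ∀ y → ι ⟨$⟩ˡ (ρ ⟨$⟩ʳ y) ≡ π ⟨$⟩ʳ (ι ⟨$⟩ˡ y)
intertwine⁻¹ ι π ρ eq y = trans
  (cong (λ z → ι ⟨$⟩ˡ (ρ ⟨$⟩ʳ z)) (sym (inverseʳ ι)))
  (trans (cong (ι ⟨$⟩ˡ_) (sym (eq _))) (inverseˡ ι))

≃-sym : {R : Rotation m} {S : Rotation n} → R ≃ S → S ≃ R
≃-sym {R = R} {S} R≃S = record
  { ι   = Perm.flip ι
  ; ι-σ = intertwine⁻¹ ι (Rotation.σ R) (Rotation.σ S) ι-σ
  ; ι-α = intertwine⁻¹ ι (Rotation.α R) (Rotation.α S) ι-α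
  }
  where open _≃_ R≃S

module _ (ι : Permutation m n) (π : Permutation′ m) (ρ : Permutation′ n)
         (eq : ∀ x → ι ⟨$⟩ʳ (π ⟨$⟩ʳ x) ≡ ρ ⟨$⟩ʳ (ι ⟨$⟩ʳ x)) where

  sameOrbit-map : ∀ {x y} → SameOrbit π x y → SameOrbit ρ (ι ⟨$⟩ʳ x) (ι ⟨$⟩ʳ y)
  sameOrbit-map = EqC.gmap (ι ⟨$⟩ʳ_) λ { refl → sym (eq _) }

module _ (ι : Permutation m n) (π : Permutation′ m) (ρ : Permutation′ n)
         (eq : ∀ x → ι ⟨$⟩ʳ (π ⟨$⟩ʳ x) ≡ ρ ⟨$⟩ʳ (ι ⟨$⟩ʳ x)) where

  private
    back : ∀ {x y} → SameOrbit ρ x y → SameOrbit π (ι ⟨$⟩ˡ x) (ι ⟨$⟩ˡ y)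
    back = sameOrbit-map (Perm.flip ι) ρ π (intertwine⁻¹ ι π ρ eq)

  sameOrbit-unmap : ∀ {x y} → SameOrbit ρ (ι ⟨$⟩ʳ x) (ι ⟨$⟩ʳ y) → SameOrbit π x y
  sameOrbit-unmap = subst₂ (SameOrbit π) (inverseˡ ι) (inverseˡ ι) ∘ back

  #orbits-≃ : #orbits π ≡ #orbits ρ
  #orbits-≃ = trans (#orbits≡∣orbits∣ π) (trans ∣orbits∣-≃ (sym (#orbits≡∣orbits∣ ρ)))
    where
    ∣orbits∣-≃ = ∣∣-cong (orbits π) (orbits ρ) record
      { to        = ι ⟨$⟩ʳ_
      ; from      = ι ⟨$⟩ˡ_
      ; to-cong   = sameOrbit-map ι π ρ eq
      ; from-cong = back
      ; inverse   = (λ c → subst (SameOrbit ρ _) (inverseʳ ι) (sameOrbit-map ι π ρ eq c))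
                  , (λ c → subst (SameOrbit π _) (inverseˡ ι) (back c))
      }

module _ {R : Rotation m} {S : Rotation n} (R≃S : R ≃ S) where
  private
    module R = Rotation R
    module S = Rotation S
  open _≃_ R≃S

  private
    i : Fin m → Fin n
    i = ι ⟨$⟩ʳ_

    ι-φ : ∀ x → i (R.φ ⟨$⟩ʳ x) ≡ S.φ ⟨$⟩ʳ (i x)
    ι-φ x = trans (ι-σ _) (cong (S.σ ⟨$⟩ʳ_) (ι-α x))

    onto : (P : Fin n → Set) → (∀ x → P (i x)) → ∀ y → P y
    onto P h y = subst P (inverseʳ ι) (h (ι ⟨$⟩ˡ y))

    vertex⇒ : ∀ {x y} → R.SameVertex x y → S.SameVertex (i x) (i y)
    vertex⇒ = sameOrbit-map ι R.σ S.σ ι-σ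

    vertex⇐ : ∀ {x y} → S.SameVertex (i x) (i y) → R.SameVertex x y
    vertex⇐ = sameOrbit-unmap ι R.σ S.σ ι-σ

    step⇒ : ∀ {x y} → R.Step x y → S.Step (i x) (i y)
    step⇒ (inj₁ refl) = inj₁ (sym (ι-σ _))
    step⇒ (inj₂ refl) = inj₂ (sym (ι-α _))

    ι-inj : ∀ {x y} → i x ≡ i y → x ≡ y
    ι-inj = perm-injective ι

  is𝐆-≃ : ∀ {r} → Is𝐆 e R r → Is𝐆 e S (ι ⟨$⟩ʳ r)
  is𝐆-≃ {r = r} g = record
    { α-involutive = onto _ λ x → begin
        S.α ⟨$⟩ʳ (S.α ⟨$⟩ʳ (i x)) ≡⟨ cong (S.α ⟨$⟩ʳ_) (ι-α x) ⟨
        S.α ⟨$⟩ʳ (i (R.α ⟨$⟩ʳ x))   ≡⟨ ι-α _ ⟨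
        i (R.α ⟨$⟩ʳ (R.α ⟨$⟩ʳ x))   ≡⟨ cong i (α-involutive x) ⟩
        i x                       ∎
    ; α-free       = onto _ λ x eq → α-free x (ι-inj (trans (ι-α x) eq))
    ; connected    = onto _ λ x → onto _ λ y → EqC.gmap i step⇒ (connected x y)
    ; euler        = trans (sym (cong₂ ℕ._+_ (#orbits-≃ ι R.σ S.σ ι-σ) (#orbits-≃ ι R.φ S.φ ι-φ))) euler
    ; φ-free       = onto _ λ x eq → φ-free x (ι-inj (trans (ι-φ x) eq))
    ; φ-cubic      = onto _ λ x → begin
        S.φ ⟨$⟩ʳ (S.φ ⟨$⟩ʳ (S.φ ⟨$⟩ʳ (i x))) ≡⟨ cong (λ y → S.φ ⟨$⟩ʳ (S.φ ⟨$⟩ʳ y)) (ι-φ x) ⟨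
        S.φ ⟨$⟩ʳ (S.φ ⟨$⟩ʳ (i (R.φ ⟨$⟩ʳ x)))   ≡⟨ cong (S.φ ⟨$⟩ʳ_) (ι-φ _) ⟨
        S.φ ⟨$⟩ʳ (i (R.φ ⟨$⟩ʳ (R.φ ⟨$⟩ʳ x)))   ≡⟨ ι-φ _ ⟨
        i (R.φ ⟨$⟩ʳ (R.φ ⟨$⟩ʳ (R.φ ⟨$⟩ʳ x)))   ≡⟨ cong i (φ-cubic x) ⟩
        i x                                  ∎
    ; loopless     = onto _ λ x c → loopless x (vertex⇐ (subst (S.SameVertex (i x)) (sym (ι-α x)) c))
    ; twoConnected = onto _ λ v → onto _ λ x → onto _ λ y p q →
        EqC.gmap i (λ (a , b , st) → a ∘ vertex⇐ , b ∘ vertex⇐ , step⇒ st)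
          (twoConnected v x y (p ∘ vertex⇒) (q ∘ vertex⇒))
    ; no-digon     = onto _ λ x p q eq → no-digon x (p ∘ vertex⇒)
        (q ∘ subst (λ y → S.SameVertex y (i x)) (ι-α r) ∘ vertex⇒)
        (ι-inj (trans (ι-σ _) (trans (cong (S.σ ⟨$⟩ʳ_) (ι-σ x)) eq)))
    }
    where open Is𝐆 g; open ≡-Reasoning

relabel : Permutation m n → Rotation m → Rotation n
relabel ι (rotation σ α) = rotation (Perm.flip ι ∘ₚ σ ∘ₚ ι) (Perm.flip ι ∘ₚ α ∘ₚ ι)

relabel-≃ : (ι : Permutation m n) (R : Rotation m) → R ≃ relabel ι R
relabel-≃ ι R = record
  { ι   = ι
  ; ι-σ = λ x → cong (λ y → ι ⟨$⟩ʳ (σ ⟨$⟩ʳ y)) (sym (inverseˡ ι))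
  ; ι-α = λ x → cong (λ y → ι ⟨$⟩ʳ (α ⟨$⟩ʳ y)) (sym (inverseˡ ι))
  }
  where open Rotation R

-- Comparing the numbers of orbits of two permutations

module OrbitSplit (π : Permutation′ m) (ρ : Permutation′ n) where

  private
    split : ℕ → Setoid 0ℓ 0ℓ
    split k = FiniteSetoid.setoid (orbits π) ⊎ₛ ≡.setoid (Fin k)

  infix 4 _≈_
  _≈_ : Rel (Fin m ⊎ Fin k) 0ℓ
  _≈_ = Pointwise (SameOrbit π) _≡_

  module _ (to : Fin n → Fin m ⊎ Fin k) (to-step : ∀ y → to y ≈ to (ρ ⟨$⟩ʳ y)) where

    to-resp : ∀ {x y} → SameOrbit ρ x y → to x ≈ to y
    to-resp = EqC.gfold (Setoid.isEquivalence (split k)) to λ { refl → to-step _ }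

  module _ (from : Fin m → Fin n) (from-step : ∀ x → SameOrbit ρ (from x) (from (π ⟨$⟩ʳ x))) where

    from-resp : ∀ {x y} → SameOrbit π x y → SameOrbit ρ (from x) (from y)
    from-resp = EqC.gfold (EqC.isEquivalence _) from λ { refl → from-step _ }

  module _ (to : Fin n → Fin m ⊎ Fin k) (to-step : ∀ y → to y ≈ to (ρ ⟨$⟩ʳ y))
           (from : Fin m → Fin n) (from-step : ∀ x → SameOrbit ρ (from x) (from (π ⟨$⟩ʳ x)))
           (extra : Fin k → Fin n)
           (to-from : ∀ z → to (Sum.[ from , extra ]′ z) ≡ z)
           (from-to : ∀ y → SameOrbit ρ (Sum.[ from , extra ]′ (to y)) y) where

    private
      both : Fin m ⊎ Fin k → Fin n
      both = Sum.[ from , extra ]′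

      both-resp : ∀ {z w} → z ≈ w → SameOrbit ρ (both z) (both w)
      both-resp (inj₁ c)    = from-resp from from-step c
      both-resp (inj₂ refl) = ε

    -- Since single steps are respected on both sides, `to` and `[ from , extra ]` descend to
    -- mutually inverse maps between the orbits of `ρ` and the orbits of `π` with `k` points added.
    -- Vertices use this with `k` equal to 1, faces with `k` equal to 2.
    #orbits-split : #orbits ρ ≡ #orbits π ℕ.+ k
    #orbits-split = trans (#orbits≡∣orbits∣ ρ) (trans (hasSize⇒∣∣≡ (orbits ρ) {split k}
      record
        { to        = both
        ; from      = to
        ; to-cong   = both-resp
        ; from-cong = to-resp to to-step
        ; inverse   = (λ z≈to → both-resp z≈to ◅◅ from-to _)
                    , (λ c → Setoid.trans (split k) (to-resp to to-step c)
                                                    (Setoid.reflexive (split k) (to-from _)))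
        }
      (⊎-hasSize (∣∣-inverse (orbits π)) (record
        { to = id ; from = id ; to-cong = id ; from-cong = id ; inverse = id , id })))
      (cong (ℕ._+ k) (sym (#orbits≡∣orbits∣ π))))

-- The darts of the insertion

-- A vertex with darts 𝑝 and 𝑞 is joined by edges (𝑝 , 𝑝′) and (𝑞 , 𝑞′) to the
-- initial vertices of the darts s and t of an edge (s , t), which is doubled:
-- the two copies are (s , 𝑠′) and (𝑡′ , t).
pattern 𝑝  = zero
pattern 𝑞  = suc zero
pattern 𝑝′ = suc (suc zero)
pattern 𝑞′ = suc (suc (suc zero))
pattern 𝑡′ = suc (suc (suc (suc zero)))
pattern 𝑠′ = suc (suc (suc (suc (suc zero))))
pattern old x = suc (suc (suc (suc (suc (suc x)))))

-- With J the exchange of s and 𝑡′ and of t and 𝑠′ (below), the map with the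
-- vertex inserted has the permutations J ∘ κ σ and J ∘ λ′ α.
κ λ′ : (Fin m → Fin m) → Fin (6 ℕ.+ m) → Fin (6 ℕ.+ m)
κ f 𝑝       = 𝑞
κ f 𝑞       = 𝑝
κ f 𝑝′      = 𝑡′
κ f 𝑡′      = 𝑝′
κ f 𝑞′      = 𝑠′
κ f 𝑠′      = 𝑞′
κ f (old x) = old (f x)
λ′ f 𝑝       = 𝑝′
λ′ f 𝑝′      = 𝑝
λ′ f 𝑞       = 𝑞′
λ′ f 𝑞′      = 𝑞
λ′ f 𝑡′      = 𝑠′
λ′ f 𝑠′      = 𝑡′
λ′ f (old x) = old (f x)

module _ {f g : Fin m → Fin m} (f∘g : ∀ x → f (g x) ≡ x) where

  κ-inverse : ∀ x → κ f (κ g x) ≡ x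
  κ-inverse 𝑝       = refl
  κ-inverse 𝑞       = refl
  κ-inverse 𝑝′      = refl
  κ-inverse 𝑡′      = refl
  κ-inverse 𝑞′      = refl
  κ-inverse 𝑠′      = refl
  κ-inverse (old x) = cong (λ y → old y) (f∘g x)

  λ′-inverse : ∀ x → λ′ f (λ′ g x) ≡ x
  λ′-inverse 𝑝       = refl
  λ′-inverse 𝑞       = refl
  λ′-inverse 𝑝′      = refl
  λ′-inverse 𝑡′      = refl
  λ′-inverse 𝑞′      = refl
  λ′-inverse 𝑠′      = refl
  λ′-inverse (old x) = cong (λ y → old y) (f∘g x)

κ-perm λ′-perm : Permutation′ m → Permutation′ (6 ℕ.+ m)
κ-perm π = permutation (κ (π ⟨$⟩ʳ_)) (κ (π ⟨$⟩ˡ_))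
  (κ-inverse λ _ → inverseʳ π) (κ-inverse λ _ → inverseˡ π)
λ′-perm π = permutation (λ′ (π ⟨$⟩ʳ_)) (λ′ (π ⟨$⟩ˡ_))
  (λ′-inverse λ _ → inverseʳ π) (λ′-inverse λ _ → inverseˡ π)

old-injective : ∀ {x y : Fin m} → _≡_ {A = Fin (6 ℕ.+ m)} (old x) (old y) → x ≡ y
old-injective refl = refl

module Ends {m} (s t : Fin m) (s≢t : s ≢ t) where

  data Position : Fin m → Set where
    at-s : Position s
    at-t : Position t
    off  : ∀ {x} → x ≢ s → x ≢ t → Position x

  position : ∀ x → Position x
  position x with x ≟ s | x ≟ t
  ... | yes refl | _        = at-s
  ... | no _     | yes refl = at-t
  ... | no x≢s   | no x≢t   = off x≢s x≢t

  byPosition : ∀ {A : Set} → A → A → A → Fin m → A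
  byPosition a b c x with x ≟ s | x ≟ t
  ... | yes _ | _     = a
  ... | no _  | yes _ = b
  ... | no _  | no _  = c

  module _ {A : Set} {a b c : A} where

    byPosition-s : byPosition a b c s ≡ a
    byPosition-s with s ≟ s
    ... | yes _  = refl
    ... | no s≢s = contradiction refl s≢s

    byPosition-t : byPosition a b c t ≡ b
    byPosition-t with t ≟ s | t ≟ t
    ... | yes t≡s | _      = contradiction (sym t≡s) s≢t
    ... | no _    | yes _  = refl
    ... | no _    | no t≢t = contradiction refl t≢t

    byPosition-off : ∀ {x} → x ≢ s → x ≢ t → byPosition a b c x ≡ c
    byPosition-off {x} x≢s x≢t with x ≟ s | x ≟ t
    ... | yes x≡s | _       = contradiction x≡s x≢s
    ... | no _    | yes x≡t = contradiction x≡t x≢t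
    ... | no _    | no _    = refl

  j : Fin m → Fin (6 ℕ.+ m)
  j x = byPosition 𝑡′ 𝑠′ (old x) x

  J : Fin (6 ℕ.+ m) → Fin (6 ℕ.+ m)
  J 𝑝       = 𝑝
  J 𝑞       = 𝑞
  J 𝑝′      = 𝑝′
  J 𝑞′      = 𝑞′
  J 𝑡′      = old s
  J 𝑠′      = old t
  J (old x) = j x

  j-s : j s ≡ 𝑡′
  j-s = byPosition-s

  j-t : j t ≡ 𝑠′
  j-t = byPosition-t

  j-off : ∀ {x} → x ≢ s → x ≢ t → j x ≡ old x
  j-off = byPosition-off

  J-involutive : ∀ x → J (J x) ≡ x
  J-involutive 𝑝  = refl
  J-involutive 𝑞  = refl
  J-involutive 𝑝′ = refl
  J-involutive 𝑞′ = refl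
  J-involutive 𝑡′ = j-s
  J-involutive 𝑠′ = j-t
  J-involutive (old x) with position x
  ... | at-s        = cong J j-s
  ... | at-t        = cong J j-t
  ... | off x≢s x≢t = trans (cong J (j-off x≢s x≢t)) (j-off x≢s x≢t)

  J-perm : Permutation′ (6 ℕ.+ m)
  J-perm = permutation J J J-involutive J-involutive

  J-injective : ∀ {x y} → J x ≡ J y → x ≡ y
  J-injective = perm-injective J-perm

  j-injective : ∀ {x y} → j x ≡ j y → x ≡ y
  j-injective eq = old-injective (J-injective eq)

  j≡old⇒≡ : ∀ {x y} → j x ≡ old y → x ≡ y
  j≡old⇒≡ {x} eq with position x
  ... | at-s        = contradiction (trans (sym j-s) eq) λ ()
  ... | at-t        = contradiction (trans (sym j-t) eq) λ ()
  ... | off x≢s x≢t = old-injective (trans (sym (j-off x≢s x≢t)) eq)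

-- Vertices and faces of the insertion

module Insertion {m} (N : Rotation m) (s t : Fin m) (s≢t : s ≢ t) where

  open Ends s t s≢t public
  module N = Rotation N

  rot : Rotation (6 ℕ.+ m)
  rot = rotation (κ-perm N.σ ∘ₚ J-perm) (λ′-perm N.α ∘ₚ J-perm)

  open Rotation rot public

  vert : Fin (6 ℕ.+ m) → Fin m ⊎ Fin 1
  vert 𝑝       = inj₂ zero
  vert 𝑞       = inj₂ zero
  vert 𝑝′      = inj₁ s
  vert 𝑞′      = inj₁ t
  vert 𝑡′      = inj₁ s
  vert 𝑠′      = inj₁ t
  vert (old x) = inj₁ x

  vert-j : ∀ x → vert (j x) ≡ inj₁ x
  vert-j x with position x
  ... | at-s        = cong vert j-s
  ... | at-t        = cong vert j-t
  ... | off x≢s x≢t = cong vert (j-off x≢s x≢t)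

  private
    module V = OrbitSplit N.σ σ

    unvert : Fin m ⊎ Fin 1 → Fin (6 ℕ.+ m)
    unvert = Sum.[ (λ x → old x) , (λ _ → 𝑝) ]′

    σ→ : ∀ {x} → SameVertex x (σ ⟨$⟩ʳ x)
    σ→ = orbit-next σ

    flipV : ∀ {x y} → SameVertex x y → SameVertex y x
    flipV = sameOrbit-sym σ

    unvert-vert : ∀ x → SameVertex (unvert (vert x)) x
    unvert-vert 𝑝       = ε
    unvert-vert 𝑞       = σ→
    unvert-vert 𝑝′      = flipV σ→
    unvert-vert 𝑞′      = flipV σ→
    unvert-vert 𝑡′      = flipV (σ→ {𝑡′} ◅◅ σ→)
    unvert-vert 𝑠′      = flipV (σ→ {𝑠′} ◅◅ σ→)
    unvert-vert (old x) = ε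

    vert-step : ∀ x → vert x V.≈ vert (σ ⟨$⟩ʳ x)
    vert-step 𝑝       = inj₂ refl
    vert-step 𝑞       = inj₂ refl
    vert-step 𝑝′      = inj₁ ε
    vert-step 𝑞′      = inj₁ ε
    vert-step 𝑡′      = inj₁ ε
    vert-step 𝑠′      = inj₁ ε
    vert-step (old x) = subst (inj₁ x V.≈_) (sym (vert-j _)) (inj₁ (orbit-next N.σ))

  vert-resp : ∀ {x y} → SameVertex x y → vert x V.≈ vert y
  vert-resp = V.to-resp vert vert-step

  -- The exchange `J` only swaps darts of the same vertex, so arguments about vertices may pass
  -- freely between `old x` and `j x`.
  old-j : ∀ x → SameVertex (old x) (j x)
  old-j x = subst (λ z → SameVertex (unvert z) (j x)) (vert-j x) (unvert-vert (j x))

  private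
    old-step : ∀ x → SameVertex (old x) (old (N.σ ⟨$⟩ʳ x))
    old-step x = σ→ {old x} ◅◅ flipV (old-j _)

  old-vertex⁺ : ∀ {x y} → N.SameVertex x y → SameVertex (old x) (old y)
  old-vertex⁺ = V.from-resp (λ x → old x) old-step

  old-vertex⁻ : ∀ {x y} → SameVertex (old x) (old y) → N.SameVertex x y
  old-vertex⁻ c with vert-resp c
  ... | inj₁ d = d

  #vertices : #orbits σ ≡ #orbits N.σ ℕ.+ 1
  #vertices = V.#orbits-split vert vert-step (λ x → old x) old-step (λ _ → 𝑝)
    (λ { (inj₁ _) → refl ; (inj₂ zero) → refl }) unvert-vert

  module _ (αs : N.α ⟨$⟩ʳ s ≡ t) (αt : N.α ⟨$⟩ʳ t ≡ s) where

    α-j : ∀ x → α ⟨$⟩ʳ j x ≡ old (N.α ⟨$⟩ʳ x)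
    α-j x with position x
    ... | at-s        = trans (cong (α ⟨$⟩ʳ_) j-s) (cong (λ y → old y) (sym αs))
    ... | at-t        = trans (cong (α ⟨$⟩ʳ_) j-t) (cong (λ y → old y) (sym αt))
    ... | off x≢s x≢t = trans (cong (α ⟨$⟩ʳ_) (j-off x≢s x≢t)) (j-off
          (λ eq → x≢t (perm-injective N.α (trans eq (sym αt))))
          (λ eq → x≢s (perm-injective N.α (trans eq (sym αs)))))

    -- The faces of N survive along the darts j x, its vertices along the darts old x.
    φ-j : ∀ x → φ ⟨$⟩ʳ j x ≡ j (N.φ ⟨$⟩ʳ x)
    φ-j x = cong (σ ⟨$⟩ʳ_) (α-j x)

    φ-s : φ ⟨$⟩ʳ old s ≡ 𝑞′
    φ-s = cong (σ ⟨$⟩ʳ_) (trans (cong j αs) j-t)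

    φ-t : φ ⟨$⟩ʳ old t ≡ 𝑝′
    φ-t = cong (σ ⟨$⟩ʳ_) (trans (cong j αt) j-s)

    -- The cases `p1`, `p2`, `p3` and `q1`, `q2`, `q3` follow `φ` round the two new triangles. In
    -- the old faces 𝑡′ and 𝑠′ stand in for `s` and `t`.
    data FaceView : Fin (6 ℕ.+ m) → Set where
      p1 : FaceView 𝑝
      p2 : FaceView (old s)
      p3 : FaceView 𝑞′
      q1 : FaceView 𝑞
      q2 : FaceView (old t)
      q3 : FaceView 𝑝′
      oldFace : ∀ x → FaceView (j x)

    faceView : ∀ x → FaceView x
    faceView 𝑝  = p1
    faceView 𝑞  = q1
    faceView 𝑝′ = q3
    faceView 𝑞′ = p3
    faceView 𝑡′ = subst FaceView j-s (oldFace s)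
    faceView 𝑠′ = subst FaceView j-t (oldFace t)
    faceView (old x) with position x
    ... | at-s        = p2
    ... | at-t        = q2
    ... | off x≢s x≢t = subst FaceView (j-off x≢s x≢t) (oldFace x)

    face : Fin (6 ℕ.+ m) → Fin m ⊎ Fin 2
    face 𝑝       = inj₂ zero
    face 𝑞       = inj₂ (suc zero)
    face 𝑝′      = inj₂ (suc zero)
    face 𝑞′      = inj₂ zero
    face 𝑡′      = inj₁ s
    face 𝑠′      = inj₁ t
    face (old x) = byPosition (inj₂ zero) (inj₂ (suc zero)) (inj₁ x) x

    face-j : ∀ x → face (j x) ≡ inj₁ x
    face-j x with position x
    ... | at-s        = cong face j-s
    ... | at-t        = cong face j-t
    ... | off x≢s x≢t = trans (cong face (j-off x≢s x≢t)) (byPosition-off x≢s x≢t)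

    private
      module F = OrbitSplit N.φ φ

      face-step : ∀ {x} → FaceView x → face x F.≈ face (φ ⟨$⟩ʳ x)
      face-step p1 = subst (inj₂ _ F.≈_) (sym byPosition-s) (inj₂ refl)
      face-step p2 = subst₂ F._≈_ (sym byPosition-s) (cong face (sym φ-s)) (inj₂ refl)
      face-step p3 = inj₂ refl
      face-step q1 = subst (inj₂ _ F.≈_) (sym byPosition-t) (inj₂ refl)
      face-step q2 = subst₂ F._≈_ (sym byPosition-t) (cong face (sym φ-t)) (inj₂ refl)
      face-step q3 = inj₂ refl
      face-step (oldFace x) = subst₂ F._≈_ (sym (face-j x)) (sym (trans (cong face (φ-j x)) (face-j _)))
        (inj₁ (orbit-next N.φ))

      extra : Fin 2 → Fin (6 ℕ.+ m)
      extra zero    = 𝑝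
      extra (suc _) = 𝑞

      j-step : ∀ x → SameOrbit φ (j x) (j (N.φ ⟨$⟩ʳ x))
      j-step x = subst (SameOrbit φ (j x)) (φ-j x) (orbit-next φ)

      unface : Fin m ⊎ Fin 2 → Fin (6 ℕ.+ m)
      unface = Sum.[ j , extra ]′

      unface-face : ∀ {x} → FaceView x → SameOrbit φ (unface (face x)) x
      unface-face p1 = ε
      unface-face p2 = subst (λ z → SameOrbit φ (unface z) (old s)) (sym byPosition-s) (orbit-next φ)
      unface-face p3 = sameOrbit-sym φ (orbit-next φ)
      unface-face q1 = ε
      unface-face q2 = subst (λ z → SameOrbit φ (unface z) (old t)) (sym byPosition-t) (orbit-next φ)
      unface-face q3 = sameOrbit-sym φ (orbit-next φ)
      unface-face (oldFace x) = subst (λ z → SameOrbit φ (unface z) (j x)) (sym (face-j x)) ε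

    #faces : #orbits φ ≡ #orbits N.φ ℕ.+ 2
    #faces = F.#orbits-split face (face-step ∘ faceView) j j-step extra
      (λ { (inj₁ x) → face-j x ; (inj₂ zero) → refl ; (inj₂ (suc zero)) → refl })
      (unface-face ∘ faceView)

    φ-cubic⁺ : (∀ x → N.φ ⟨$⟩ʳ (N.φ ⟨$⟩ʳ (N.φ ⟨$⟩ʳ x)) ≡ x) →
               ∀ x → φ ⟨$⟩ʳ (φ ⟨$⟩ʳ (φ ⟨$⟩ʳ x)) ≡ x
    φ-cubic⁺ cubic = cubic′ ∘ faceView
      where
      cubic′ : ∀ {x} → FaceView x → φ ⟨$⟩ʳ (φ ⟨$⟩ʳ (φ ⟨$⟩ʳ x)) ≡ x
      cubic′ p1 = cong (φ ⟨$⟩ʳ_) φ-s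
      cubic′ p2 = cong (λ y → φ ⟨$⟩ʳ (φ ⟨$⟩ʳ y)) φ-s
      cubic′ p3 = φ-s
      cubic′ q1 = cong (φ ⟨$⟩ʳ_) φ-t
      cubic′ q2 = cong (λ y → φ ⟨$⟩ʳ (φ ⟨$⟩ʳ y)) φ-t
      cubic′ q3 = φ-t
      cubic′ (oldFace x) =
        trans (cong (λ y → φ ⟨$⟩ʳ (φ ⟨$⟩ʳ y)) (φ-j x))
        (trans (cong (φ ⟨$⟩ʳ_) (φ-j _)) (trans (φ-j _) (cong j (cubic x))))

    φ-cubic⁻ : (∀ x → φ ⟨$⟩ʳ (φ ⟨$⟩ʳ (φ ⟨$⟩ʳ x)) ≡ x) →
               ∀ x → N.φ ⟨$⟩ʳ (N.φ ⟨$⟩ʳ (N.φ ⟨$⟩ʳ x)) ≡ x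
    φ-cubic⁻ cubic x = j-injective (trans (sym
      (trans (cong (λ y → φ ⟨$⟩ʳ (φ ⟨$⟩ʳ y)) (φ-j x)) (trans (cong (φ ⟨$⟩ʳ_) (φ-j _)) (φ-j _))))
      (cubic (j x)))

    φ-free⁺ : (∀ x → N.φ ⟨$⟩ʳ x ≢ x) → ∀ x → φ ⟨$⟩ʳ x ≢ x
    φ-free⁺ free = free′ ∘ faceView
      where
      free′ : ∀ {x} → FaceView x → φ ⟨$⟩ʳ x ≢ x
      free′ p1 ()
      free′ p2 eq = contradiction (trans (sym φ-s) eq) λ ()
      free′ p3 ()
      free′ q1 ()
      free′ q2 eq = contradiction (trans (sym φ-t) eq) λ ()
      free′ q3 ()
      free′ (oldFace x) eq = free x (j-injective (trans (sym (φ-j x)) eq))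

    φ-free⁻ : (∀ x → φ ⟨$⟩ʳ x ≢ x) → ∀ x → N.φ ⟨$⟩ʳ x ≢ x
    φ-free⁻ free x eq = free (j x) (trans (φ-j x) (cong j eq))

    α-involutive⁺ : (∀ x → N.α ⟨$⟩ʳ (N.α ⟨$⟩ʳ x) ≡ x) → ∀ x → α ⟨$⟩ʳ (α ⟨$⟩ʳ x) ≡ x
    α-involutive⁺ inv 𝑝       = refl
    α-involutive⁺ inv 𝑞       = refl
    α-involutive⁺ inv 𝑝′      = refl
    α-involutive⁺ inv 𝑞′      = refl
    α-involutive⁺ inv 𝑡′      = trans (cong j αt) j-s
    α-involutive⁺ inv 𝑠′      = trans (cong j αs) j-t
    α-involutive⁺ inv (old x) = trans (α-j _) (cong (λ y → old y) (inv x))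

    α-involutive⁻ : (∀ x → α ⟨$⟩ʳ (α ⟨$⟩ʳ x) ≡ x) → ∀ x → N.α ⟨$⟩ʳ (N.α ⟨$⟩ʳ x) ≡ x
    α-involutive⁻ inv x = old-injective (trans (sym (α-j _)) (inv (old x)))

    α-free⁺ : (∀ x → N.α ⟨$⟩ʳ x ≢ x) → ∀ x → α ⟨$⟩ʳ x ≢ x
    α-free⁺ free (old x) eq = free x (j≡old⇒≡ eq)

    α-free⁻ : (∀ x → α ⟨$⟩ʳ x ≢ x) → ∀ x → N.α ⟨$⟩ʳ x ≢ x
    α-free⁻ free x eq with position x
    ... | at-s        = s≢t (trans (sym eq) αs)
    ... | at-t        = s≢t (trans (sym αt) eq)
    ... | off x≢s x≢t = free (old x) (trans (cong j eq) (j-off x≢s x≢t))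

    private
      j-vertex⁻ : ∀ {x y} → SameVertex (old x) (j y) → N.SameVertex x y
      j-vertex⁻ c = old-vertex⁻ (c ◅◅ flipV (old-j _))

    loopless⁺ : N.Loopless → Loopless
    loopless⁺ ll 𝑝  c with () ← vert-resp c
    loopless⁺ ll 𝑞  c with () ← vert-resp c
    loopless⁺ ll 𝑝′ c with () ← vert-resp c
    loopless⁺ ll 𝑞′ c with () ← vert-resp c
    loopless⁺ ll 𝑡′ c = ll s (subst (N.SameVertex s) (sym αs) (old-vertex⁻ (unvert-vert 𝑡′ ◅◅ c)))
    loopless⁺ ll 𝑠′ c = ll t (subst (N.SameVertex t) (sym αt) (old-vertex⁻ (unvert-vert 𝑠′ ◅◅ c)))
    loopless⁺ ll (old x) c = ll x (j-vertex⁻ c)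

    loopless⁻ : Loopless → N.Loopless
    loopless⁻ ll x c = ll (old x) (old-vertex⁺ c ◅◅ old-j _)

    -- Connectivity of the insertion

    -- The inserted vertex retracts onto an end z of the doubled edge that is
    -- itself not deleted.
    module Retraction (A : Fin (6 ℕ.+ m) → Set) (A-resp : ∀ {x y} → SameVertex x y → A x → A y)
                      (z : Fin m) (z-end : z ≡ s ⊎ z ≡ t) (Az : A (old z)) where

      home : Fin (6 ℕ.+ m) → Fin m
      home x = Sum.[ id , (λ _ → z) ]′ (vert x)

      private
        Aₙ : Fin m → Set
        Aₙ x = A (old x)

        J→ : Rel (Fin (6 ℕ.+ m)) 0ℓ
        J→ = Joined rot A

        to-end : ∀ {x y} → A x → SameVertex x y → J→ x y
        to-end = vertex-joined rot A-resp

        lift-step : ∀ {x y} → Aₙ x × Aₙ y × N.Step x y → J→ (old x) (old y)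
        lift-step (a , _ , inj₁ refl) = to-end a (old-step _)
        -- The reverse of `old x` is `j` of the reverse of `x`, so after crossing the edge one may
        -- still have to turn round the vertex.
        lift-step (a , b , inj₂ refl) =
          fwd (a , A-resp (old-j _) b , inj₂ refl) ◅ joined-sym rot (to-end b (old-j _))

        edge : ∀ {x y} → Aₙ x → Aₙ y → N.α ⟨$⟩ʳ x ≡ y → Joined N Aₙ x y
        edge a b eq = fwd (a , b , inj₂ eq) ◅ ε

        -- A passage through the inserted vertex shrinks to the edge from `s` to `t` or to nothing.
        -- That edge is available because both of its ends lie in `A`.
        end-s : ∀ {y} → y ≡ s ⊎ y ≡ t → Aₙ y → Aₙ s → Joined N Aₙ y s
        end-s (inj₁ refl) a b = ε
        end-s (inj₂ refl) a b = edge a b αt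

        end-t : ∀ {y} → y ≡ s ⊎ y ≡ t → Aₙ y → Aₙ t → Joined N Aₙ y t
        end-t (inj₁ refl) a b = edge a b αs
        end-t (inj₂ refl) a b = ε

        home-j : ∀ x → home (j x) ≡ x
        home-j x = cong Sum.[ id , (λ _ → z) ]′ (vert-j x)

        at : ∀ x → A x → A (unvert (vert x))
        at x = A-resp (flipV (unvert-vert x))

        σ-step : ∀ x → A x → A (σ ⟨$⟩ʳ x) → Joined N Aₙ (home x) (home (σ ⟨$⟩ʳ x))
        σ-step 𝑝  a b = ε
        σ-step 𝑞  a b = ε
        σ-step 𝑝′ a b = ε
        σ-step 𝑞′ a b = ε
        σ-step 𝑡′ a b = ε
        σ-step 𝑠′ a b = ε
        σ-step (old x) a b = subst (Joined N Aₙ x) (sym (home-j _))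
          (fwd (a , A-resp (flipV (old-j _)) b , inj₁ refl) ◅ ε)

        α-step : ∀ x → A x → A (α ⟨$⟩ʳ x) → Joined N Aₙ (home x) (home (α ⟨$⟩ʳ x))
        α-step 𝑝  a b = end-s z-end Az (at 𝑝′ b)
        α-step 𝑞  a b = end-t z-end Az (at 𝑞′ b)
        α-step 𝑝′ a b = joined-sym N (end-s z-end Az (at 𝑝′ a))
        α-step 𝑞′ a b = joined-sym N (end-t z-end Az (at 𝑞′ a))
        α-step 𝑡′ a b = edge (at 𝑡′ a) b αs
        α-step 𝑠′ a b = edge (at 𝑠′ a) b αt
        α-step (old x) a b = subst (Joined N Aₙ x) (sym (home-j _))
          (edge a (A-resp (flipV (old-j _)) b) refl)

        p-end : ∀ {y} → y ≡ s ⊎ y ≡ t → Aₙ y → A 𝑝 → J→ 𝑝 (old y)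
        p-end (inj₁ refl) b a =
          fwd (a , A-resp (unvert-vert 𝑝′) b , inj₂ refl) ◅ joined-sym rot (to-end b (unvert-vert 𝑝′))
        p-end (inj₂ refl) b a = to-end a σ→
          ◅◅ fwd (A-resp σ→ a , A-resp (unvert-vert 𝑞′) b , inj₂ refl)
          ◅ joined-sym rot (to-end b (unvert-vert 𝑞′))

        go-home : ∀ x → A x → J→ x (old (home x))
        go-home 𝑝       a = p-end z-end Az a
        go-home 𝑞       a = to-end a σ→ ◅◅ p-end z-end Az (A-resp σ→ a)
        go-home 𝑝′      a = to-end a (flipV (unvert-vert 𝑝′))
        go-home 𝑞′      a = to-end a (flipV (unvert-vert 𝑞′))
        go-home 𝑡′      a = to-end a (flipV (unvert-vert 𝑡′))
        go-home 𝑠′      a = to-end a (flipV (unvert-vert 𝑠′))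
        go-home (old x) a = ε

      joined⁺ : ∀ {x y} → A x → A y → Joined N (λ w → A (old w)) (home x) (home y) → Joined rot A x y
      joined⁺ a b c = go-home _ a
        ◅◅ EqC.gfold (EqC.isEquivalence _) (λ x → old x) lift-step c
        ◅◅ joined-sym rot (go-home _ b)

      joined⁻ : ∀ {x y} → Joined rot A x y → Joined N (λ w → A (old w)) (home x) (home y)
      joined⁻ = EqC.gfold (EqC.isEquivalence _) home
        λ { (a , b , inj₁ refl) → σ-step _ a b ; (a , b , inj₂ refl) → α-step _ a b }

    private
      module Everything = Retraction (λ _ → ⊤) (λ _ _ → tt) s (inj₁ refl) tt

    connected⁺ : N.Connected → Connected
    connected⁺ conn x y = EqC.map (proj₂ ∘ proj₂)
      (Everything.joined⁺ tt tt (EqC.map (λ st → tt , tt , st) (conn _ _)))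

    connected⁻ : Connected → N.Connected
    connected⁻ conn x y = EqC.map (proj₂ ∘ proj₂)
      (Everything.joined⁻ {old x} {old y} (EqC.map (λ st → tt , tt , st) (conn _ _)))

    -- The edge from `s` to `t` is not a loop, so deleting one vertex cannot remove both of its
    -- ends.
    surviving-end : N.Loopless → ∀ w → ∃ λ z → (z ≡ s ⊎ z ≡ t) × ¬ N.SameVertex w z
    surviving-end ll w with sameOrbit? N.σ w s
    ... | no ¬ws = s , inj₁ refl , ¬ws
    ... | yes ws = t , inj₂ refl , λ wt → ll s (subst (N.SameVertex s) (sym αs) (sameOrbit-sym N.σ ws ◅◅ wt))

    twoConnected⁻ : N.Loopless → TwoConnected → N.TwoConnected
    twoConnected⁻ ll two w x y ¬wx ¬wy =
      let z , z-end , ¬wz = surviving-end ll w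
          open Retraction (λ y → ¬ SameVertex (old w) y) (λ c ¬d d → ¬d (d ◅◅ flipV c))
                          z z-end (¬wz ∘ old-vertex⁻)
      in EqC.map (λ (a , b , st) → a ∘ old-vertex⁺ , b ∘ old-vertex⁺ , st)
           (joined⁻ {old x} {old y} (two (old w) (old x) (old y) (¬wx ∘ old-vertex⁻) (¬wy ∘ old-vertex⁻)))

    twoConnected⁺ : N.Loopless → N.Connected → N.TwoConnected → TwoConnected
    twoConnected⁺ ll conn two v x y ¬vx ¬vy with vert v in eq
    -- Deleting the inserted vertex leaves every vertex of `N`, so here connectedness of `N` is what
    -- is needed.
    ... | inj₂ zero = joined⁺ ¬vx ¬vy (EqC.map (λ st → ¬v , ¬v , st) (conn _ _))
      where
      ¬v : ∀ {x} → ¬ SameVertex v (old x)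
      ¬v c with () ← subst (V._≈ inj₁ _) eq (vert-resp c)
      open Retraction (λ y → ¬ SameVertex v y) (λ c ¬d d → ¬d (d ◅◅ flipV c)) s (inj₁ refl) ¬v
    ... | inj₁ w = joined⁺ ¬vx ¬vy (EqC.map (λ (a , b , st) → a ∘ v∼ , b ∘ v∼ , st)
                     (two w (home x) (home y) (away x ¬vx) (away y ¬vy)))
      where
      w∼v : SameVertex (old w) v
      w∼v = subst (λ u → SameVertex (unvert u) v) eq (unvert-vert v)
      v∼ : ∀ {x} → SameVertex v (old x) → N.SameVertex w x
      v∼ c = old-vertex⁻ (w∼v ◅◅ c)
      end = surviving-end ll w
      z = proj₁ end
      ¬wz = proj₂ (proj₂ end)
      open Retraction (λ y → ¬ SameVertex v y) (λ c ¬d d → ¬d (d ◅◅ flipV c))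
                      z (proj₁ (proj₂ end)) (¬wz ∘ v∼)
      away : ∀ x → ¬ SameVertex v x → ¬ N.SameVertex w (home x)
      away x ¬vx c with vert x in eqx
      ... | inj₂ _ = ¬wz c
      ... | inj₁ u = ¬vx (flipV w∼v ◅◅ old-vertex⁺ c
                          ◅◅ subst (λ u → SameVertex (unvert u) x) eqx (unvert-vert x))

    -- Away from the ends of the doubled edge `j` agrees with `old` on the darts involved, so the
    -- rotation there is that of `N`.
    no-digon⁻ : (∀ x → ¬ SameVertex 𝑝 x → ¬ SameVertex 𝑝′ x → σ ⟨$⟩ʳ (σ ⟨$⟩ʳ x) ≢ x) →
                ∀ x → ¬ N.SameVertex s x → ¬ N.SameVertex t x → N.σ ⟨$⟩ʳ (N.σ ⟨$⟩ʳ x) ≢ x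
    no-digon⁻ nd x ¬sx ¬tx eq = nd (old x)
      (λ c → contradiction (vert-resp c) λ ())
      (λ c → ¬sx (old-vertex⁻ (unvert-vert 𝑝′ ◅◅ c)))
      (trans (cong (σ ⟨$⟩ʳ_) (j-off (¬sx ∘ from ∘ sym) (¬tx ∘ from ∘ sym)))
             (trans (cong j eq) (j-off (λ { refl → ¬sx ε }) (λ { refl → ¬tx ε }))))
      where
      from : ∀ {y} → y ≡ N.σ ⟨$⟩ʳ x → N.SameVertex y x
      from refl = sameOrbit-sym N.σ (orbit-next N.σ)

    -- Besides the vertices away from the doubled edge, the vertex of `t` has to be checked: it is
    -- incident to the root of `N` but not to the new root. The darts 𝑠′, 𝑞′ and `old t` follow one
    -- another there, so its degree is at least 3.
    no-digon⁺ : (∀ x → ¬ N.SameVertex s x → ¬ N.SameVertex t x → N.σ ⟨$⟩ʳ (N.σ ⟨$⟩ʳ x) ≢ x) →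
                ∀ x → ¬ SameVertex 𝑝 x → ¬ SameVertex 𝑝′ x → σ ⟨$⟩ʳ (σ ⟨$⟩ʳ x) ≢ x
    no-digon⁺ nd x ¬px ¬p′x eq with vert x in eqx
    ... | inj₂ zero = ¬px (subst (λ u → SameVertex (unvert u) x) eqx (unvert-vert x))
    ... | inj₁ u = nd u ¬su ¬tu (j≡old⇒≡ (trans
            (sym (cong (σ ⟨$⟩ʳ_) (j-off (¬su ∘ from ∘ sym) (¬tu ∘ from ∘ sym))))
            (digon-invariant σ (flipV u∼x) eq)))
      where
      u∼x : SameVertex (old u) x
      u∼x = subst (λ u → SameVertex (unvert u) x) eqx (unvert-vert x)
      ¬su : ¬ N.SameVertex s u
      ¬su c = ¬p′x (flipV (unvert-vert 𝑝′) ◅◅ old-vertex⁺ c ◅◅ u∼x)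
      ¬tu : ¬ N.SameVertex t u
      ¬tu c = contradiction
        (digon-invariant σ (flipV (flipV (unvert-vert 𝑠′) ◅◅ old-vertex⁺ c ◅◅ u∼x)) eq) λ ()
      from : ∀ {y} → y ≡ N.σ ⟨$⟩ʳ u → N.SameVertex y u
      from refl = sameOrbit-sym N.σ (orbit-next N.σ)

-- Insertion preserves and reflects membership in `𝐆`

module _ {m} (N : Rotation m) (s t : Fin m) (s≢t : s ≢ t) where
  open Insertion N s t s≢t

  private
    euler-shift : ∀ v f → (v ℕ.+ 1) ℕ.+ (f ℕ.+ 2) ≡ 3 ℕ.+ (v ℕ.+ f)
    euler-shift = solve 2 (λ v f → (v :+ con 1) :+ (f :+ con 2) := con 3 :+ (v :+ f)) refl
      where open ℕ.+-*-Solver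

    -- One vertex and two faces are added, which balances the three new edges in Euler's formula.
    euler-insertion : N.α ⟨$⟩ʳ s ≡ t → N.α ⟨$⟩ʳ t ≡ s →
                      #orbits σ ℕ.+ #orbits φ ≡ 3 ℕ.+ (#orbits N.σ ℕ.+ #orbits N.φ)
    euler-insertion αs αt = trans (cong₂ ℕ._+_ #vertices (#faces αs αt)) (euler-shift (#orbits N.σ) (#orbits N.φ))

  is𝐆-insert : N.α ⟨$⟩ʳ s ≡ t → Is𝐆 e N s → Is𝐆 (3 ℕ.+ e) rot 𝑝
  is𝐆-insert αs g = record
    { α-involutive = α-involutive⁺ αs αt α-involutive
    ; α-free       = α-free⁺ αs αt α-free
    ; connected    = connected⁺ αs αt connected
    ; euler        = trans (euler-insertion αs αt) (cong (3 ℕ.+_) euler)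
    ; φ-free       = φ-free⁺ αs αt φ-free
    ; φ-cubic      = φ-cubic⁺ αs αt φ-cubic
    ; loopless     = loopless⁺ αs αt loopless
    ; twoConnected = twoConnected⁺ αs αt loopless connected twoConnected
    ; no-digon     = no-digon⁺ αs αt λ x ¬sx ¬tx → no-digon x ¬sx (¬tx ∘ subst (λ y → N.SameVertex y x) αs)
    }
    where
    open Is𝐆 g
    αt = trans (cong (N.α ⟨$⟩ʳ_) (sym αs)) (α-involutive s)

  is𝐆-collapse : N.α ⟨$⟩ʳ s ≡ t → N.α ⟨$⟩ʳ t ≡ s → Is𝐆 (3 ℕ.+ e) rot 𝑝 → Is𝐆 e N s
  is𝐆-collapse αs αt g = record
    { α-involutive = α-involutive⁻ αs αt α-involutive
    ; α-free       = α-free⁻ αs αt α-free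
    ; connected    = connected⁻ αs αt connected
    ; euler        = ℕ.+-cancelˡ-≡ 3 _ _ (trans (sym (euler-insertion αs αt)) euler)
    ; φ-free       = φ-free⁻ αs αt φ-free
    ; φ-cubic      = φ-cubic⁻ αs αt φ-cubic
    ; loopless     = loopless′
    ; twoConnected = twoConnected⁻ αs αt loopless′ twoConnected
    ; no-digon     = λ x ¬sx ¬tx → no-digon⁻ αs αt no-digon x ¬sx (¬tx ∘ subst (λ y → N.SameVertex y x) (sym αs))
    }
    where
    open Is𝐆 g
    loopless′ = loopless⁻ αs αt loopless

  -- The dart after 𝑝′ is `old s`, and the one after that is in the image of the old darts under
  -- `J`, whereas `J` fixes 𝑝′. So the neighbour of the new vertex along the root has degree at
  -- least 3.
  p′-no-digon : σ ⟨$⟩ʳ (σ ⟨$⟩ʳ 𝑝′) ≢ 𝑝′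
  p′-no-digon eq = contradiction (J-injective {old _} {𝑝′} eq) λ ()

-- Restricting and extending permutations along an initial segment

fixing⇒shifted : ∀ k (π : Permutation (k ℕ.+ m) (k ℕ.+ n)) →
                 (∀ i → π ⟨$⟩ʳ (i ↑ˡ m) ≡ i ↑ˡ n) →
                 ∃ λ (ρ : Permutation m n) → ∀ x → π ⟨$⟩ʳ (k ↑ʳ x) ≡ k ↑ʳ (ρ ⟨$⟩ʳ x)
fixing⇒shifted zero    π fix = π , λ _ → refl
fixing⇒shifted (suc k) π fix
  with fixing⇒shifted k (remove zero π) (λ i → suc-injective (trans (lift₀-remove π (fix zero) _) (fix (suc i))))
... | ρ , shift = ρ , λ x → trans (sym (lift₀-remove π (fix zero) _)) (cong suc (shift x))

-- This lets any `k` distinct darts be taken as the first `k` labels. The value at `zero` is punched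
-- out of the others and inserted again after the recursion.
injective⇒extension : ∀ k → n ≡ k ℕ.+ m → (f : Fin k → Fin n) → (∀ i j → f i ≡ f j → i ≡ j) →
                      ∃ λ (π : Permutation (k ℕ.+ m) n) → ∀ i → π ⟨$⟩ʳ (i ↑ˡ m) ≡ f i
injective⇒extension zero    refl f inj = Perm.id , λ ()
injective⇒extension {m = m} (suc k) refl f inj = insert zero (f zero) π , λ
  { zero    → refl
  ; (suc i) → trans (insert-punchIn zero (f zero) π (i ↑ˡ m))
                    (trans (cong (punchIn (f zero)) (extends i)) (punchIn-punchOut (f0≢ i)))
  }
  where
  f0≢ : ∀ i → f zero ≢ f (suc i)
  f0≢ i eq with () ← inj zero (suc i) eq
  rec = injective⇒extension {m = m} k refl (λ i → punchOut (f0≢ i))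
    (λ i j eq → suc-injective (inj (suc i) (suc j) (punchOut-injective (f0≢ i) (f0≢ j) eq)))
  π = proj₁ rec
  extends = proj₂ rec

outside⇒shifted : ∀ k (ι : Permutation (k ℕ.+ m) n) {y} → (∀ i → y ≢ ι ⟨$⟩ʳ (i ↑ˡ m)) →
                  ∃ λ x → ι ⟨$⟩ʳ (k ↑ʳ x) ≡ y
outside⇒shifted k ι {y} y≢ with splitAt k (ι ⟨$⟩ˡ y) in eq
... | inj₁ i = contradiction (sym (trans (cong (ι ⟨$⟩ʳ_) (splitAt⁻¹-↑ˡ eq)) (inverseʳ ι))) (y≢ i)
... | inj₂ x = x , trans (cong (ι ⟨$⟩ʳ_) (splitAt⁻¹-↑ʳ eq)) (inverseʳ ι)

-- Read through the labelling `ι` and followed by the inverse of `h`, the permutation `τ` fixes the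
-- first `k` labels, so it restricts to the others. For `h` built from `J` this is the step that
-- undoes the exchange.
intertwining⇒shifted : ∀ k (ι : Permutation (k ℕ.+ m) n) (τ : Permutation′ n) (h : Permutation′ (k ℕ.+ m)) →
                       (∀ i → τ ⟨$⟩ʳ (ι ⟨$⟩ʳ (i ↑ˡ m)) ≡ ι ⟨$⟩ʳ (h ⟨$⟩ʳ (i ↑ˡ m))) →
                       ∃ λ (ρ : Permutation′ m) →
                         ∀ x → ι ⟨$⟩ʳ (h ⟨$⟩ʳ (k ↑ʳ (ρ ⟨$⟩ʳ x))) ≡ τ ⟨$⟩ʳ (ι ⟨$⟩ʳ (k ↑ʳ x))
intertwining⇒shifted {m} k ι τ h eq
  with fixing⇒shifted {m} {m} k (ι ∘ₚ τ ∘ₚ Perm.flip ι ∘ₚ Perm.flip h)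
    (λ i → trans (cong (λ y → h ⟨$⟩ˡ (ι ⟨$⟩ˡ y)) (eq i))
                 (trans (cong (h ⟨$⟩ˡ_) (inverseˡ ι)) (inverseˡ h)))
... | ρ , shift = ρ , λ x → trans
  (cong (λ y → ι ⟨$⟩ʳ (h ⟨$⟩ʳ y)) (sym (shift x)))
  (trans (cong (ι ⟨$⟩ʳ_) (inverseʳ h)) (inverseʳ ι))

-- Collapsing a root end of degree 2

module Collapse {m n} (n≡6+m : n ≡ 6 ℕ.+ m) (M : Rotation n) (p : Fin n) (g : Is𝐆 e M p)
                (digon : Rotation.σ M ⟨$⟩ʳ (Rotation.σ M ⟨$⟩ʳ p) ≡ p) where
  open Rotation M
  open Is𝐆 g

  private
    q  = σ ⟨$⟩ʳ p
    p′ = α ⟨$⟩ʳ p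
    q′ = α ⟨$⟩ʳ q
    s  = σ ⟨$⟩ʳ p′
    t  = σ ⟨$⟩ʳ q′
    s′ = α ⟨$⟩ʳ s
    t′ = α ⟨$⟩ʳ t

    -- The face of `p` runs through `p`, `s` and `σ s′`, so `φ` sends `σ s′` back to `p`. It also
    -- sends `q′` to `σ q`, which is `p` by the digon. The mirrored argument gives `σt′`.
    σs′ : σ ⟨$⟩ʳ s′ ≡ q′
    σs′ = perm-injective φ (trans (φ-cubic p)
      (sym (trans (cong (σ ⟨$⟩ʳ_) (α-involutive q)) digon)))

    σt′ : σ ⟨$⟩ʳ t′ ≡ p′
    σt′ = perm-injective φ (trans (φ-cubic q)
      (sym (cong (σ ⟨$⟩ʳ_) (α-involutive p))))

    σ→ : ∀ {x} → SameVertex x (σ ⟨$⟩ʳ x)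
    σ→ = orbit-next σ

    flipV : ∀ {x y} → SameVertex x y → SameVertex y x
    flipV = sameOrbit-sym σ

    apart : ∀ {u v x y} → ¬ SameVertex u v → SameVertex u x → SameVertex v y → x ≢ y
    apart ¬uv ux vy refl = ¬uv (ux ◅◅ flipV vy)

    t′∼p′ : SameVertex p′ t′
    t′∼p′ = flipV (subst (SameVertex t′) σt′ σ→)

    s′∼q′ : SameVertex q′ s′
    s′∼q′ = flipV (subst (SameVertex s′) σs′ σ→)

    ¬vb : ¬ SameVertex p q′
    ¬vb c = loopless q (flipV σ→ ◅◅ c)

    ¬ab : ¬ SameVertex p′ q′
    ¬ab c = loopless s (flipV σ→ ◅◅ c ◅◅ s′∼q′)

    va : ∀ {x y} → SameVertex p x → SameVertex p′ y → x ≢ y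
    va = apart (loopless p)

    vb : ∀ {x y} → SameVertex p x → SameVertex q′ y → x ≢ y
    vb = apart ¬vb

    ab : ∀ {x y} → SameVertex p′ x → SameVertex q′ y → x ≢ y
    ab = apart ¬ab

    α≡ : ∀ {x y} → x ≡ y → α ⟨$⟩ʳ x ≡ α ⟨$⟩ʳ y
    α≡ = cong (α ⟨$⟩ʳ_)

    -- Otherwise q′ lies at a second vertex of degree 2, off the root edge.
    s≢t′ : s ≢ t′
    s≢t′ eq = no-digon q′ ¬vb ¬ab
      (trans (cong (σ ⟨$⟩ʳ_) (sym (trans (α≡ eq) (α-involutive t)))) σs′)

    -- The order is that of the patterns 𝑝, 𝑞, 𝑝′, 𝑞′, 𝑡′, 𝑠′, so that the labelling sends each of
    -- them to its namesake.
    removed : List (Fin n)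
    removed = p ∷ q ∷ p′ ∷ q′ ∷ t′ ∷ s′ ∷ []

    -- Most pairs lie at different vertices among `v`, `a` and `b`; pairs at the same vertex are
    -- separated by their reverses, apart from `s` and `t′`, to which `t` and `s′` reduce. The list
    -- starts with `s` and `t` because these two must be seen to survive the removal.
    distinct : Unique (s ∷ t ∷ removed)
    distinct =
      (ab σ→ σ→ ∷ (va ε σ→ ∘ sym) ∷ (va σ→ σ→ ∘ sym)
        ∷ (λ eq → vb ε s′∼q′ (sym (trans (α≡ eq) (α-involutive p)))) ∷ ab σ→ ε
        ∷ s≢t′ ∷ ab σ→ s′∼q′ ∷ []) ∷
      ((vb ε σ→ ∘ sym) ∷ (vb σ→ σ→ ∘ sym) ∷ (ab ε σ→ ∘ sym)
        ∷ (λ eq → va σ→ t′∼p′ (sym (trans (α≡ eq) (α-involutive q)))) ∷ (ab t′∼p′ σ→ ∘ sym)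
        ∷ (λ eq → s≢t′ (sym (trans (α≡ eq) (α-involutive s)))) ∷ []) ∷
      ((ab ε ε ∘ α≡) ∷ va ε ε ∷ vb ε ε ∷ va ε t′∼p′ ∷ vb ε s′∼q′ ∷ []) ∷
      (va σ→ ε ∷ vb σ→ ε ∷ va σ→ t′∼p′ ∷ vb σ→ s′∼q′ ∷ []) ∷
      (ab ε ε ∷ (λ eq → vb ε σ→ (trans (sym (α-involutive p)) (trans (α≡ eq) (α-involutive t))))
        ∷ ab ε s′∼q′ ∷ []) ∷
      ((ab t′∼p′ ε ∘ sym) ∷ (λ eq → va σ→ σ→ (trans (sym (α-involutive q)) (trans (α≡ eq) (α-involutive s)))) ∷ []) ∷
      (ab t′∼p′ s′∼q′ ∷ []) ∷ [] ∷ []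

    opaque
      extension : ∃ λ (ι : Permutation (6 ℕ.+ m) n) → ∀ j → ι ⟨$⟩ʳ (j ↑ˡ m) ≡ lookup removed j
      extension = injective⇒extension {m = m} 6 n≡6+m (lookup removed)
        (unique-lookup-injective (AllPairs.tail (AllPairs.tail distinct)))

  ι : Permutation (6 ℕ.+ m) n
  ι = proj₁ extension

  private
    i : Fin (6 ℕ.+ m) → Fin n
    i = ι ⟨$⟩ʳ_

    ι-removed : ∀ j → i (j ↑ˡ m) ≡ lookup removed j
    ι-removed = proj₂ extension

    opaque
      kept : ∀ {y} → All.All (y ≢_) removed → ∃ λ x → i (old x) ≡ y
      kept all = outside⇒shifted 6 ι λ j eq → All.lookup all (∈-lookup {xs = removed} j) (trans eq (ι-removed j))

    s-kept = kept (All.tail (AllPairs.head distinct))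
    t-kept = kept (AllPairs.head (AllPairs.tail distinct))

  s₀ t₀ : Fin m
  s₀ = proj₁ s-kept
  t₀ = proj₁ t-kept

  private
    ι-s : i (old s₀) ≡ s
    ι-s = proj₂ s-kept

    ι-t : i (old t₀) ≡ t
    ι-t = proj₂ t-kept

  ι-p : ι ⟨$⟩ʳ 𝑝 ≡ p
  ι-p = ι-removed zero

  private
    ι-q : i 𝑞 ≡ q
    ι-q = ι-removed (suc zero)

    ι-p′ : i 𝑝′ ≡ p′
    ι-p′ = ι-removed (suc (suc zero))

    ι-q′ : i 𝑞′ ≡ q′
    ι-q′ = ι-removed (suc (suc (suc zero)))

    ι-t′ : i 𝑡′ ≡ t′
    ι-t′ = ι-removed (suc (suc (suc (suc zero))))

    ι-s′ : i 𝑠′ ≡ s′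
    ι-s′ = ι-removed (suc (suc (suc (suc (suc zero)))))

  s₀≢t₀ : s₀ ≢ t₀
  s₀≢t₀ eq = All.head (AllPairs.head distinct) (trans (sym ι-s) (trans (cong (λ x → i (old x)) eq) ι-t))

  private
    module E = Ends s₀ t₀ s₀≢t₀
    open E using (J; j; J-perm; j-injective)

    via : ∀ {τ : Permutation′ n} {x y x′ y′} → i x ≡ x′ → i y ≡ y′ → τ ⟨$⟩ʳ x′ ≡ y′ →
          τ ⟨$⟩ʳ i x ≡ i y
    via refl refl eq = eq

    -- On the six new darts `κ` does not depend on its argument, so `id` can stand for the rotation
    -- of the collapsed map, which is only about to be obtained. The same holds for `λ′` below.
    σ-new : ∀ x → σ ⟨$⟩ʳ i (x ↑ˡ m) ≡ i (J (κ id (x ↑ˡ m)))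
    σ-new 𝑝  = via {σ} ι-p ι-q refl
    σ-new 𝑞  = via {σ} ι-q ι-p digon
    σ-new 𝑝′ = via {σ} ι-p′ ι-s refl
    σ-new 𝑞′ = via {σ} ι-q′ ι-t refl
    σ-new 𝑡′ = via {σ} ι-t′ ι-p′ σt′
    σ-new 𝑠′ = via {σ} ι-s′ ι-q′ σs′

    α-new : ∀ x → α ⟨$⟩ʳ i (x ↑ˡ m) ≡ i (J (λ′ id (x ↑ˡ m)))
    α-new 𝑝  = via {α} ι-p ι-p′ refl
    α-new 𝑞  = via {α} ι-q ι-q′ refl
    α-new 𝑝′ = via {α} ι-p′ ι-p (α-involutive p)
    α-new 𝑞′ = via {α} ι-q′ ι-q (α-involutive q)
    α-new 𝑡′ = via {α} ι-t′ ι-t (α-involutive t)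
    α-new 𝑠′ = via {α} ι-s′ ι-s (α-involutive s)

    opaque
      σ-old : ∃ λ (ρ : Permutation′ m) → ∀ x → i (j (ρ ⟨$⟩ʳ x)) ≡ σ ⟨$⟩ʳ i (old x)
      σ-old = intertwining⇒shifted 6 ι σ (κ-perm Perm.id ∘ₚ J-perm) σ-new

      α-old : ∃ λ (ρ : Permutation′ m) → ∀ x → i (j (ρ ⟨$⟩ʳ x)) ≡ α ⟨$⟩ʳ i (old x)
      α-old = intertwining⇒shifted 6 ι α (λ′-perm Perm.id ∘ₚ J-perm) α-new

  collapsed : Rotation m
  collapsed = rotation (proj₁ σ-old) (proj₁ α-old)

  module C = Rotation collapsed

  open Insertion collapsed s₀ t₀ s₀≢t₀ using (rot)

  rot≃M : rot ≃ M
  rot≃M = record { ι = ι ; ι-σ = ι-σ ; ι-α = ι-α }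
    where
    ι-σ : ∀ x → i (Rotation.σ rot ⟨$⟩ʳ x) ≡ σ ⟨$⟩ʳ i x
    ι-σ 𝑝       = sym (σ-new 𝑝)
    ι-σ 𝑞       = sym (σ-new 𝑞)
    ι-σ 𝑝′      = sym (σ-new 𝑝′)
    ι-σ 𝑞′      = sym (σ-new 𝑞′)
    ι-σ 𝑡′      = sym (σ-new 𝑡′)
    ι-σ 𝑠′      = sym (σ-new 𝑠′)
    ι-σ (old x) = proj₂ σ-old x
    ι-α : ∀ x → i (Rotation.α rot ⟨$⟩ʳ x) ≡ α ⟨$⟩ʳ i x
    ι-α 𝑝       = sym (α-new 𝑝)
    ι-α 𝑞       = sym (α-new 𝑞)
    ι-α 𝑝′      = sym (α-new 𝑝′)
    ι-α 𝑞′      = sym (α-new 𝑞′)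
    ι-α 𝑡′      = sym (α-new 𝑡′)
    ι-α 𝑠′      = sym (α-new 𝑠′)
    ι-α (old x) = proj₂ α-old x

  -- In `M` the reverse of `s` is `s′`, and `J` puts `t` in its place: this merges the two parallel
  -- edges.
  αs₀ : C.α ⟨$⟩ʳ s₀ ≡ t₀
  αs₀ = j-injective (perm-injective ι (begin
    i (j (C.α ⟨$⟩ʳ s₀)) ≡⟨ proj₂ α-old s₀ ⟩
    α ⟨$⟩ʳ i (old s₀)   ≡⟨ α≡ ι-s ⟩
    s′                  ≡⟨ ι-s′ ⟨
    i 𝑠′                ≡⟨ cong i E.j-t ⟨
    i (j t₀)            ∎))
    where open ≡-Reasoning

  αt₀ : C.α ⟨$⟩ʳ t₀ ≡ s₀
  αt₀ = j-injective (perm-injective ι (begin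
    i (j (C.α ⟨$⟩ʳ t₀)) ≡⟨ proj₂ α-old t₀ ⟩
    α ⟨$⟩ʳ i (old t₀)   ≡⟨ α≡ ι-t ⟩
    t′                  ≡⟨ ι-t′ ⟨
    i 𝑡′                ≡⟨ cong i E.j-s ⟨
    i (j s₀)            ∎))
    where open ≡-Reasoning

-- Isomorphisms that respect a chosen dart

-- Unlike `_≅_`, this compares bare rotation systems, whose numbers of darts may differ in form, so
-- insertions can be compared before being made into rooted maps.
record Pointed≃ (R : Rotation m) (r : Fin m) (S : Rotation n) (s : Fin n) : Set where
  constructor pointed
  field
    R≃S   : R ≃ S
  open _≃_ R≃S public
  field
    ι-pt : ι ⟨$⟩ʳ r ≡ s

module _ {R : Rotation m} {r : Fin m} {S : Rotation n} {s : Fin n} (E : Pointed≃ R r S s) where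
  open Pointed≃ E

  pointed-sym : Pointed≃ S s R r
  pointed-sym = pointed (≃-sym R≃S) (trans (cong (ι ⟨$⟩ˡ_) (sym ι-pt)) (inverseˡ ι))

  pointed-reverse : Pointed≃ R (Rotation.α R ⟨$⟩ʳ r) S (Rotation.α S ⟨$⟩ʳ s)
  pointed-reverse = pointed R≃S (trans (ι-α r) (cong (Rotation.α S ⟨$⟩ʳ_) ι-pt))

  pointed-digon : Rotation.σ R ⟨$⟩ʳ (Rotation.σ R ⟨$⟩ʳ r) ≡ r → Rotation.σ S ⟨$⟩ʳ (Rotation.σ S ⟨$⟩ʳ s) ≡ s
  pointed-digon digon = begin
    S.σ ⟨$⟩ʳ (S.σ ⟨$⟩ʳ s)           ≡⟨ cong (λ x → S.σ ⟨$⟩ʳ (S.σ ⟨$⟩ʳ x)) ι-pt ⟨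
    S.σ ⟨$⟩ʳ (S.σ ⟨$⟩ʳ (ι ⟨$⟩ʳ r))  ≡⟨ cong (S.σ ⟨$⟩ʳ_) (ι-σ r) ⟨
    S.σ ⟨$⟩ʳ (ι ⟨$⟩ʳ (R.σ ⟨$⟩ʳ r))  ≡⟨ ι-σ _ ⟨
    ι ⟨$⟩ʳ (R.σ ⟨$⟩ʳ (R.σ ⟨$⟩ʳ r))  ≡⟨ cong (ι ⟨$⟩ʳ_) digon ⟩
    ι ⟨$⟩ʳ r                        ≡⟨ ι-pt ⟩
    s                               ∎
    where
    open ≡-Reasoning
    module R = Rotation R
    module S = Rotation S

  pointed-is𝐆 : Is𝐆 e R r → Is𝐆 e S s
  pointed-is𝐆 g = subst (Is𝐆 _ S) ι-pt (is𝐆-≃ R≃S g)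

pointed-trans : ∀ {o} {R : Rotation m} {r} {S : Rotation n} {s} {T : Rotation o} {t} →
                Pointed≃ R r S s → Pointed≃ S s T t → Pointed≃ R r T t
pointed-trans E F = pointed
  (record { ι   = E.ι ∘ₚ F.ι
          ; ι-σ = λ x → trans (cong (F.ι ⟨$⟩ʳ_) (E.ι-σ x)) (F.ι-σ _)
          ; ι-α = λ x → trans (cong (F.ι ⟨$⟩ʳ_) (E.ι-α x)) (F.ι-α _) })
  (trans (cong (F.ι ⟨$⟩ʳ_) E.ι-pt) F.ι-pt)
  where
  module E = Pointed≃ E
  module F = Pointed≃ F

relabel-pointed : (ι : Permutation m n) (R : Rotation m) (r : Fin m) → Pointed≃ R r (relabel ι R) (ι ⟨$⟩ʳ r)
relabel-pointed ι R r = pointed (relabel-≃ ι R) refl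

≅⇒pointed : {M N : RootedMap e} → M ≅ N →
            Pointed≃ (RootedMap.rot M) (RootedMap.root M) (RootedMap.rot N) (RootedMap.root N)
≅⇒pointed (iso π π-σ π-α π-root) = pointed (record { ι = π ; ι-σ = π-σ ; ι-α = π-α }) π-root

pointed⇒≅ : {M N : RootedMap e} →
            Pointed≃ (RootedMap.rot M) (RootedMap.root M) (RootedMap.rot N) (RootedMap.root N) → M ≅ N
pointed⇒≅ E = iso ι ι-σ ι-α ι-pt
  where open Pointed≃ E

module _ {m} {N N′ : Rotation m} {s t s′ t′ : Fin m} (s≢t : s ≢ t) (s′≢t′ : s′ ≢ t′) where
  private
    module N  = Rotation N
    module N′ = Rotation N′
    module I  = Insertion N s t s≢t
    module I′ = Insertion N′ s′ t′ s′≢t′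

    module _ {Ψ : Fin (6 ℕ.+ m) → Fin (6 ℕ.+ m)} (ψ : Permutation′ m)
             (Ψ-s : Ψ 𝑠′ ≡ 𝑠′) (Ψ-t : Ψ 𝑡′ ≡ 𝑡′) (Ψ-old : ∀ x → Ψ (old x) ≡ old (ψ ⟨$⟩ʳ x))
             (ψ-s : ψ ⟨$⟩ʳ s ≡ s′) (ψ-t : ψ ⟨$⟩ʳ t ≡ t′) where

      j-natural : ∀ x → Ψ (I.j x) ≡ I′.j (ψ ⟨$⟩ʳ x)
      j-natural x with I.position x
      ... | I.at-s = trans (cong Ψ I.j-s) (trans Ψ-t (sym (trans (cong I′.j ψ-s) I′.j-s)))
      ... | I.at-t = trans (cong Ψ I.j-t) (trans Ψ-s (sym (trans (cong I′.j ψ-t) I′.j-t)))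
      ... | I.off x≢s x≢t = trans (cong Ψ (I.j-off x≢s x≢t)) (trans (Ψ-old x) (sym (I′.j-off
              (λ eq → x≢s (perm-injective ψ (trans eq (sym ψ-s))))
              (λ eq → x≢t (perm-injective ψ (trans eq (sym ψ-t)))))))

  insertion-≃ : (E : Pointed≃ N s N′ s′) → Pointed≃.ι E ⟨$⟩ʳ t ≡ t′ → Pointed≃ I.rot 𝑝 I′.rot 𝑝
  insertion-≃ E ι-t = pointed (record { ι = Ψ ; ι-σ = Ψ-σ ; ι-α = Ψ-α }) refl
    where
    open Pointed≃ E
    Ψ = lift₀ (lift₀ (lift₀ (lift₀ (lift₀ (lift₀ ι)))))
    natural = j-natural {Ψ ⟨$⟩ʳ_} ι refl refl (λ _ → refl) ι-pt ι-t
    Ψ-σ : ∀ x → Ψ ⟨$⟩ʳ (I.σ ⟨$⟩ʳ x) ≡ I′.σ ⟨$⟩ʳ (Ψ ⟨$⟩ʳ x)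
    Ψ-σ 𝑝       = refl
    Ψ-σ 𝑞       = refl
    Ψ-σ 𝑝′      = cong (λ y → old y) ι-pt
    Ψ-σ 𝑞′      = cong (λ y → old y) ι-t
    Ψ-σ 𝑡′      = refl
    Ψ-σ 𝑠′      = refl
    Ψ-σ (old x) = trans (natural _) (cong I′.j (ι-σ x))
    Ψ-α : ∀ x → Ψ ⟨$⟩ʳ (I.α ⟨$⟩ʳ x) ≡ I′.α ⟨$⟩ʳ (Ψ ⟨$⟩ʳ x)
    Ψ-α 𝑝       = refl
    Ψ-α 𝑞       = refl
    Ψ-α 𝑝′      = refl
    Ψ-α 𝑞′      = refl
    Ψ-α 𝑡′      = cong (λ y → old y) ι-t
    Ψ-α 𝑠′      = cong (λ y → old y) ι-pt
    Ψ-α (old x) = trans (natural _) (cong I′.j (ι-α x))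

  -- All six new darts, and also `s` and `t`, are reached from 𝑝 by the two permutations. An
  -- isomorphism fixing 𝑝 is therefore forced on them, and what remains is a permutation of the old
  -- darts.
  insertion-≃⁻¹ : N.α ⟨$⟩ʳ s ≡ t → N.α ⟨$⟩ʳ t ≡ s → N′.α ⟨$⟩ʳ s′ ≡ t′ → N′.α ⟨$⟩ʳ t′ ≡ s′ →
                  Pointed≃ I.rot 𝑝 I′.rot 𝑝 → Pointed≃ N s N′ s′
  insertion-≃⁻¹ αs αt αs′ αt′ E = pointed (record { ι = ψ ; ι-σ = ψ-σ ; ι-α = ψ-α }) ψ-s
    where
    open Pointed≃ E
    Ψ : Fin (6 ℕ.+ m) → Fin (6 ℕ.+ m)
    Ψ = ι ⟨$⟩ʳ_
    along-σ : ∀ {x x′ y y′} → Ψ x ≡ x′ → I.σ ⟨$⟩ʳ x ≡ y → I′.σ ⟨$⟩ʳ x′ ≡ y′ → Ψ y ≡ y′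
    along-σ refl refl refl = ι-σ _
    along-α : ∀ {x x′ y y′} → Ψ x ≡ x′ → I.α ⟨$⟩ʳ x ≡ y → I′.α ⟨$⟩ʳ x′ ≡ y′ → Ψ y ≡ y′
    along-α refl refl refl = ι-α _
    Ψ-q  : Ψ 𝑞 ≡ 𝑞
    Ψ-q  = along-σ ι-pt refl refl
    Ψ-p′ : Ψ 𝑝′ ≡ 𝑝′
    Ψ-p′ = along-α ι-pt refl refl
    Ψ-q′ : Ψ 𝑞′ ≡ 𝑞′
    Ψ-q′ = along-α Ψ-q refl refl
    Ψ-s : Ψ (old s) ≡ old s′
    Ψ-s  = along-σ Ψ-p′ refl refl
    Ψ-t : Ψ (old t) ≡ old t′
    Ψ-t  = along-σ Ψ-q′ refl refl
    Ψ-s′ : Ψ 𝑠′ ≡ 𝑠′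
    Ψ-s′ = along-α Ψ-s (trans (cong I.j αs) I.j-t) (trans (cong I′.j αs′) I′.j-t)
    Ψ-t′ : Ψ 𝑡′ ≡ 𝑡′
    Ψ-t′ = along-α Ψ-t (trans (cong I.j αt) I.j-s) (trans (cong I′.j αt′) I′.j-s)
    fixes : ∀ i → Ψ (i ↑ˡ m) ≡ i ↑ˡ m
    fixes 𝑝  = ι-pt
    fixes 𝑞  = Ψ-q
    fixes 𝑝′ = Ψ-p′
    fixes 𝑞′ = Ψ-q′
    fixes 𝑡′ = Ψ-t′
    fixes 𝑠′ = Ψ-s′
    opaque
      restriction : ∃ λ (ψ : Permutation′ m) → ∀ x → Ψ (old x) ≡ old (ψ ⟨$⟩ʳ x)
      restriction = fixing⇒shifted 6 ι fixes
    ψ = proj₁ restriction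
    Ψ-old = proj₂ restriction
    ψ-s : ψ ⟨$⟩ʳ s ≡ s′
    ψ-s = old-injective (trans (sym (Ψ-old s)) Ψ-s)
    ψ-t : ψ ⟨$⟩ʳ t ≡ t′
    ψ-t = old-injective (trans (sym (Ψ-old t)) Ψ-t)
    natural = j-natural {Ψ} ψ Ψ-s′ Ψ-t′ Ψ-old ψ-s ψ-t
    ψ-σ : ∀ x → ψ ⟨$⟩ʳ (N.σ ⟨$⟩ʳ x) ≡ N′.σ ⟨$⟩ʳ (ψ ⟨$⟩ʳ x)
    ψ-σ x = I′.j-injective (trans (sym (natural _)) (along-σ (Ψ-old x) refl refl))
    ψ-α : ∀ x → ψ ⟨$⟩ʳ (N.α ⟨$⟩ʳ x) ≡ N′.α ⟨$⟩ʳ (ψ ⟨$⟩ʳ x)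
    ψ-α x = I′.j-injective (trans (sym (natural _)) (along-α (Ψ-old x) refl refl))

-- The bijection behind the recurrence

toMap : {R : Rotation (2 ℕ.* e)} {r : Fin (2 ℕ.* e)} → Is𝐆 e R r → ∃ (𝐆 {e})
toMap g = _ , is𝐆⇒𝐆 g

module _ (e : ℕ) where

  private
    darts : 6 ℕ.+ 2 ℕ.* e ≡ 2 ℕ.* (3 ℕ.+ e)
    darts = sym (ℕ.*-distribˡ-+ 2 3 e)

    opaque
      θ : Permutation (6 ℕ.+ 2 ℕ.* e) (2 ℕ.* (3 ℕ.+ e))
      θ = Perm.cast-id darts

    module Inserted (M : ∃ (𝐆 {e})) where
      open RootedMap (proj₁ M) using (rot; root; α; α-free; α-involutive)

      root≢ : root ≢ α ⟨$⟩ʳ root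
      root≢ = α-free root ∘ sym

      open Insertion rot root (α ⟨$⟩ʳ root) root≢ public
        using () renaming (rot to bare)

      inserted : Rotation (2 ℕ.* (3 ℕ.+ e))
      inserted = relabel θ bare

      start : Fin (2 ℕ.* (3 ℕ.+ e))
      start = θ ⟨$⟩ʳ 𝑝

      bare-inserted : Pointed≃ bare 𝑝 inserted start
      bare-inserted = relabel-pointed θ bare 𝑝

      is𝐆 : Is𝐆 (3 ℕ.+ e) inserted start
      is𝐆 = pointed-is𝐆 bare-inserted (is𝐆-insert _ _ _ root≢ refl (𝐆⇒is𝐆 (proj₂ M)))

      digon : Rotation.σ inserted ⟨$⟩ʳ (Rotation.σ inserted ⟨$⟩ʳ start) ≡ start
      digon = pointed-digon bare-inserted refl

      finish : Fin (2 ℕ.* (3 ℕ.+ e))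
      finish = Rotation.α inserted ⟨$⟩ʳ start

      -- The origin of the root has degree 2 at `start` but not at `finish`, so a map rooted at
      -- `start` is never isomorphic to one rooted at `finish`, even when they come from different
      -- smaller maps.
      no-digon : Rotation.σ inserted ⟨$⟩ʳ (Rotation.σ inserted ⟨$⟩ʳ finish) ≢ finish
      no-digon eq = p′-no-digon rot root _ root≢
        (pointed-digon (pointed-sym (pointed-reverse bare-inserted)) eq)

    Source = ∃ (𝐆* {3 ℕ.+ e}) ⊎ (∃ (𝐆 {e}) ⊎ ∃ (𝐆 {e}))

    source target : Setoid 0ℓ 0ℓ
    source = FiniteSetoid.setoid (𝐆*-maps (3 ℕ.+ e)) ⊎ₛ
             (FiniteSetoid.setoid (𝐆-maps e) ⊎ₛ FiniteSetoid.setoid (𝐆-maps e))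
    target = FiniteSetoid.setoid (𝐆-maps (3 ℕ.+ e))

    fromStart fromFinish : ∃ (𝐆 {e}) → ∃ (𝐆 {3 ℕ.+ e})
    fromStart  M = toMap (Inserted.is𝐆 M)
    fromFinish M = toMap (is𝐆-reverse (Inserted.is𝐆 M))

    forget : ∃ (𝐆* {3 ℕ.+ e}) → ∃ (𝐆 {3 ℕ.+ e})
    forget (M , mk𝐆* tri ns deg) = M , mk𝐆 tri ns (λ x _ → deg x)

    classify : Source → ∃ (𝐆 {3 ℕ.+ e})
    classify = Sum.[ forget , Sum.[ fromStart , fromFinish ]′ ]′

    start-cong : ∀ M N → proj₁ M ≅ proj₁ N →
                 Pointed≃ (Inserted.inserted M) (Inserted.start M) (Inserted.inserted N) (Inserted.start N)
    start-cong M N M≅N = pointed-trans (pointed-sym (Inserted.bare-inserted M))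
      (pointed-trans (insertion-≃ (Inserted.root≢ M) (Inserted.root≢ N) (≅⇒pointed M≅N)
                       (Pointed≃.ι-pt (pointed-reverse (≅⇒pointed M≅N))))
                     (Inserted.bare-inserted N))

    start-injective : ∀ M N →
      Pointed≃ (Inserted.inserted M) (Inserted.start M) (Inserted.inserted N) (Inserted.start N) →
      proj₁ M ≅ proj₁ N
    start-injective M N E = pointed⇒≅
      (insertion-≃⁻¹ (Inserted.root≢ M) (Inserted.root≢ N)
        refl (RootedMap.α-involutive (proj₁ M) _) refl (RootedMap.α-involutive (proj₁ N) _)
        (pointed-trans (Inserted.bare-inserted M) (pointed-trans E (pointed-sym (Inserted.bare-inserted N)))))

    unreverse : ∀ M N →
      Pointed≃ (Inserted.inserted M) (Inserted.finish M) (Inserted.inserted N) (Inserted.finish N) →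
      Pointed≃ (Inserted.inserted M) (Inserted.start M) (Inserted.inserted N) (Inserted.start N)
    unreverse M N E = subst₂ (λ x y → Pointed≃ (Inserted.inserted M) x (Inserted.inserted N) y)
      (Is𝐆.α-involutive (Inserted.is𝐆 M) _) (Is𝐆.α-involutive (Inserted.is𝐆 N) _) (pointed-reverse E)

    classify-cong : ∀ {x y} → Setoid._≈_ source x y → proj₁ (classify x) ≅ proj₁ (classify y)
    classify-cong (inj₁ M≅N) = M≅N
    classify-cong {inj₂ (inj₁ M)} {inj₂ (inj₁ N)} (inj₂ (inj₁ M≅N)) = pointed⇒≅ (start-cong M N M≅N)
    classify-cong {inj₂ (inj₂ M)} {inj₂ (inj₂ N)} (inj₂ (inj₂ M≅N)) =
      pointed⇒≅ (pointed-reverse (start-cong M N M≅N))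

    𝐆*-no-digon : ∀ {M : RootedMap (3 ℕ.+ e)} → 𝐆* M → ∀ {n} {S : Rotation n} {s} →
                  Rotation.σ S ⟨$⟩ʳ (Rotation.σ S ⟨$⟩ʳ s) ≡ s →
                  ¬ Pointed≃ (RootedMap.rot M) (RootedMap.root M) S s
    𝐆*-no-digon {M} M* digon E = orbitSize≥3⁻ (RootedMap.σ M) _ (𝐆*.degree≥3 M* _)
      (pointed-digon (pointed-sym E) digon)

    finish-digon⇒¬𝐆* : ∀ {M : RootedMap (3 ℕ.+ e)} → 𝐆* M → ∀ N →
      ¬ Pointed≃ (RootedMap.rot M) (RootedMap.root M) (Inserted.inserted N) (Inserted.finish N)
    finish-digon⇒¬𝐆* {M} M* N E = orbitSize≥3⁻ (RootedMap.σ M) _ (𝐆*.degree≥3 M* _)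
      (pointed-digon (pointed-sym (pointed-reverse E))
        (subst (λ x → σ ⟨$⟩ʳ (σ ⟨$⟩ʳ x) ≡ x) (sym (Is𝐆.α-involutive (Inserted.is𝐆 N) _)) (Inserted.digon N)))
      where open Rotation (Inserted.inserted N)

    classify-injective : ∀ {x y} → proj₁ (classify x) ≅ proj₁ (classify y) → Setoid._≈_ source x y
    classify-injective {inj₁ M} {inj₁ N} c = inj₁ c
    classify-injective {inj₁ (M , M*)} {inj₂ (inj₁ N)} c =
      contradiction (≅⇒pointed c) (𝐆*-no-digon {M} M* (Inserted.digon N))
    classify-injective {inj₁ (M , M*)} {inj₂ (inj₂ N)} c =
      contradiction (≅⇒pointed c) (finish-digon⇒¬𝐆* {M} M* N)
    classify-injective {inj₂ (inj₁ M)} {inj₁ (N , N*)} c =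
      contradiction (pointed-sym (≅⇒pointed c)) (𝐆*-no-digon {N} N* (Inserted.digon M))
    classify-injective {inj₂ (inj₂ M)} {inj₁ (N , N*)} c =
      contradiction (pointed-sym (≅⇒pointed c)) (finish-digon⇒¬𝐆* {N} N* M)
    classify-injective {inj₂ (inj₁ M)} {inj₂ (inj₁ N)} c =
      inj₂ (inj₁ (start-injective M N (≅⇒pointed c)))
    classify-injective {inj₂ (inj₁ M)} {inj₂ (inj₂ N)} c =
      contradiction (pointed-digon (≅⇒pointed c) (Inserted.digon M)) (Inserted.no-digon N)
    classify-injective {inj₂ (inj₂ M)} {inj₂ (inj₁ N)} c =
      contradiction (pointed-digon (pointed-sym (≅⇒pointed c)) (Inserted.digon N)) (Inserted.no-digon M)
    classify-injective {inj₂ (inj₂ M)} {inj₂ (inj₂ N)} c =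
      inj₂ (inj₂ (start-injective M N (unreverse M N (≅⇒pointed c))))

    digon⇒inserted : ∀ {R : Rotation (2 ℕ.* (3 ℕ.+ e))} {p} → Is𝐆 (3 ℕ.+ e) R p →
                     Rotation.σ R ⟨$⟩ʳ (Rotation.σ R ⟨$⟩ʳ p) ≡ p →
                     ∃ λ N → Pointed≃ (Inserted.inserted N) (Inserted.start N) R p
    digon⇒inserted {R} {p} g digon = N , pointed-trans (pointed-sym (Inserted.bare-inserted N))
      -- `Inserted` doubles the edge from `s₀` to `C.α s₀`, the collapse the one from `s₀` to `t₀`.
      -- These agree only through `αs₀`, so the identity is lifted to an isomorphism of the two
      -- insertions.
      (pointed-trans (insertion-≃ (Inserted.root≢ N) s₀≢t₀ identity αs₀) (pointed rot≃M ι-p))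
      where
      open Collapse (sym darts) R p g digon
      N : ∃ (𝐆 {e})
      N = toMap {R = collapsed} {s₀} (is𝐆-collapse collapsed s₀ t₀ s₀≢t₀ αs₀ αt₀
            (pointed-is𝐆 (pointed-sym (pointed rot≃M ι-p)) g))
      identity : Pointed≃ collapsed s₀ collapsed s₀
      identity = pointed (record { ι = Perm.id ; ι-σ = λ _ → refl ; ι-α = λ _ → refl }) refl

    classify-surjective : ∀ y → ∃ λ x → proj₁ (classify x) ≅ proj₁ y
    classify-surjective (M , G-M) = by-cases (σ ⟨$⟩ʳ (σ ⟨$⟩ʳ root) ≟ root)
                                             (σ ⟨$⟩ʳ (σ ⟨$⟩ʳ (α ⟨$⟩ʳ root)) ≟ α ⟨$⟩ʳ root)
      where
      open RootedMap M
      by-cases : Dec (σ ⟨$⟩ʳ (σ ⟨$⟩ʳ root) ≡ root) → Dec (σ ⟨$⟩ʳ (σ ⟨$⟩ʳ (α ⟨$⟩ʳ root)) ≡ α ⟨$⟩ʳ root) →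
                 ∃ λ x → proj₁ (classify x) ≅ M
      by-cases (yes digon) _ =
        let N , E = digon⇒inserted (𝐆⇒is𝐆 {M = M} G-M) digon
        in inj₂ (inj₁ N) , pointed⇒≅ E
      by-cases (no _) (yes digon) =
        let N , E = digon⇒inserted (is𝐆-reverse (𝐆⇒is𝐆 {M = M} G-M)) digon
        in inj₂ (inj₂ N) , pointed⇒≅ (subst (Pointed≃ _ _ rot) (α-involutive root) (pointed-reverse E))
      by-cases (no ¬root) (no ¬αroot) =
        inj₁ (M , mk𝐆* triangulation nonSeparable min-degree) , IsEquivalence.refl ≅-isEquivalence
        where
        open 𝐆 G-M
        min-degree : ∀ x → 3 ℕ.≤ degree x
        min-degree x with sameOrbit? σ root x | sameOrbit? σ (α ⟨$⟩ʳ root) x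
        ... | yes c | _     = orbitSize≥3⁺ σ x (¬root ∘ digon-invariant σ (sameOrbit-sym σ c))
        ... | no _  | yes c = orbitSize≥3⁺ σ x (¬αroot ∘ digon-invariant σ (sameOrbit-sym σ c))
        ... | no ¬c | no ¬d = degree≥3 x Sum.[ ¬c , ¬d ]

    classification : Bijection source target
    classification = record
      { to        = classify
      ; cong      = classify-cong
      ; bijective = classify-injective
                  , λ y → let x , c = classify-surjective y in
                      x , λ {z} z≈x → IsEquivalence.trans ≅-isEquivalence
                        {proj₁ (classify z)} {proj₁ (classify x)} {proj₁ y} (classify-cong z≈x) c
      }

  𝐆-count : ∣ 𝐆-maps (3 ℕ.+ e) ∣ ≡ ∣ 𝐆*-maps (3 ℕ.+ e) ∣ ℕ.+ (∣ 𝐆-maps e ∣ ℕ.+ ∣ 𝐆-maps e ∣)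
  𝐆-count = hasSize⇒∣∣≡ (𝐆-maps (3 ℕ.+ e)) (Bijection⇒Inverse classification)
    (⊎-hasSize (∣∣-inverse (𝐆*-maps (3 ℕ.+ e)))
               (⊎-hasSize (∣∣-inverse (𝐆-maps e)) (∣∣-inverse (𝐆-maps e))))

-- Coefficients of the generating functions

G-suc : ∀ n → G (suc n) ≡ G* (suc n) ℤ.+ (G n ℤ.+ G n)
G-suc n = subst (λ e → + ∣ 𝐆-maps e ∣ ≡ + ∣ 𝐆*-maps e ∣ ℤ.+ (G n ℤ.+ G n)) (sym (ℕ.*-suc 3 n))
  (cong +_ (𝐆-count (3 ℕ.* n)))

sum-zero : ∀ n (f : Fin n → ℤ) → (∀ i → f i ≡ + 0) → sum f ≡ + 0
sum-zero zero    f f≡0 = refl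
sum-zero (suc n) f f≡0 = cong₂ ℤ._+_ (f≡0 zero) (sum-zero n (f ∘ suc) (f≡0 ∘ suc))

theorem7 : G* ≗ 1−2t ⊛ G
-- A map without edges has no dart to serve as root, so both constant terms vanish.
theorem7 zero = trans (cong +_ (empty⇒∣∣≡0 (𝐆*-maps 0) λ ()))
  (cong (λ k → + 1 ℤ.* + k ℤ.+ + 0) (sym (empty⇒∣∣≡0 (𝐆-maps 0) λ ())))
theorem7 (suc n) = begin
  G* (suc n)                                              ≡⟨ isolate (G* (suc n)) (G n) ⟩
  + 1 ℤ.* (G* (suc n) ℤ.+ (G n ℤ.+ G n)) ℤ.+ (ℤ.- + 2 ℤ.* G n ℤ.+ + 0)
    ≡⟨ cong (λ g → + 1 ℤ.* g ℤ.+ (ℤ.- + 2 ℤ.* G n ℤ.+ + 0)) (G-suc n) ⟨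
  + 1 ℤ.* G (suc n) ℤ.+ (ℤ.- + 2 ℤ.* G n ℤ.+ + 0)
    -- The remaining summands carry the coefficients of `1−2t` from the square of `t` onwards, which
    -- are zero.
    ≡⟨ cong (λ z → + 1 ℤ.* G (suc n) ℤ.+ (ℤ.- + 2 ℤ.* G n ℤ.+ z))
         (sum-zero n _ λ i → ℤ.*-zeroˡ (G (suc n ℕ.∸ toℕ (suc (suc i))))) ⟨
  (1−2t ⊛ G) (suc n)                                      ∎
  where
  open ≡-Reasoning
  isolate : ∀ a b → a ≡ + 1 ℤ.* (a ℤ.+ (b ℤ.+ b)) ℤ.+ (ℤ.- + 2 ℤ.* b ℤ.+ + 0)
  isolate = solve 2 (λ a b → a := con (+ 1) :* (a :+ (b :+ b)) :+ (con (ℤ.- + 2) :* b :+ con (+ 0))) refl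
    where open ℤ.+-*-Solver
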